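{- If $\mathcal{K}$ is a critical group of an arithmetical structure on the star graph $S_n$ (or on the complete graph $K_n$) for $n\geq 2$, then \[\lvert\mathcal{K}\rvert<\frac{n!}{2}\,a_{n-2}^2.\]
   Context: The sequence $a_n$ is defined by the recursion $a_n=a_{n-1}^2+a_{n-1}$ with $a_1=1$; its first few terms are $1,2,6,42,1806,3263442,\dotsc$. Equivalently, $a_n=s_n-1=\prod_{i=1}^{n-1}s_i$, where $s_n$ is the $n$-th term of Sylvester's sequence, given by $s_1=2$ and $s_{n+1}=s_n^2-s_n+1$. An arithmetical structure on a finite, connected, loopless graph $G$ with vertex set $V(G)$ is a pair $(\mathbf{d},\mathbf{r})$, where $\mathbf{r}=(r_v)_{v\in V(G)}$ consists of positive integers with no common factor, $\mathbf{d}=(d_v)_{v\in V(G)}$ consists of nonnegative integers, and for every vertex $v$ we have $r_vd_v=\sum r_u$, the sum being over all $u$ adjacent to $v$ (with multiplicity in the case of non-simple graphs). Its critical group is the torsion part of the cokernel (over $\mathbb{Z}$) of the matrix $\operatorname{diag}(\mathbf{d})-A(G)$, where $A(G)$ is the adjacency matrix of $G$ and $\operatorname{diag}(\mathbf{d})$ is the diagonal matrix with the vector $\mathbf{d}$ on the diagonal. The star graph $S_n$ has $n$ leaves, each joined by one edge to a single central vertex (and no other edges), so it has $n+1$ vertices. $K_n$ denotes the (simple) complete graph on $n$ vertices.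
   Formalization: The strict inequality fails at n = 3 (K_3 with all r = 1 has order 3, equal to the bound), and a_0 is undefined at n = 2; what is proved is the bound with ≤ for all n ≥ 2, taking a_0 = 1, and with strict < for n ≥ 4. -}

module Defs where

open import Algebra.Bundles using (AbelianGroup)
import Algebra.Construct.Pointwise as Pointwise
import Algebra.Properties.CommutativeMonoid.Mult as CommutativeMonoidMult
import Algebra.Properties.Group as GroupProperties
import Algebra.Properties.Semiring.Sum as SemiringSum
open import Data.Fin.Base using (Fin; zero; suc)
open import Data.Fin.Properties using (_≟_)
open import Data.Integer.Base as ℤ using (ℤ; +_)
import Data.Integer.Properties as ℤ
open import Data.Integer.Tactic.RingSolver using (solve-∀)
open import Data.Nat.Base as ℕ using (ℕ; zero; suc; _<_; s≤s; z≤n)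
open import Data.Nat.Divisibility using (_∣_)
import Data.Nat.Properties as ℕ
open import Data.Product.Base using (Σ; ∃; _×_; _,_; proj₁)
open import Function.Bundles using (Inverse)
open import Level using (_⊔_; 0ℓ)
open import Relation.Binary.Construct.Closure.ReflexiveTransitive
  using (Star; ε; _◅_)
open import Relation.Binary.PropositionalEquality
  using (_≡_; _≢_; refl; sym; trans; cong; cong₂; setoid)
open import Relation.Nullary using (yes; no; contradiction)
open import Relation.Nullary.Decidable using (does)
open import Data.Bool.Base using (if_then_else_)

module ∑ℕ = SemiringSum ℕ.+-*-semiring
module ∑ℤ = SemiringSum ℤ.+-*-semiring

-- The sequence starts at a 1 = 1.  No natural number a₀ satisfies
-- a₀ ^ 2 + a₀ = 1; the value a 0 = 1 is a convention, the (empty) product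
-- of the Sylvester numbers s₁, …, sₙ₋₁ for n = 0.  With it, the bound
-- (n ! / 2) * a (n ∸ 2) ^ 2 equals 1 at n = 2 and 3 at n = 3, which are the
-- orders of the critical groups of the Laplacians (r = 1) of K₂ and K₃; so
-- for these n only the non-strict inequality holds.
a : ℕ → ℕ
a 0             = 1
a 1             = 1
a (suc (suc n)) = a (suc n) ℕ.^ 2 ℕ.+ a (suc n)

-- Finite, connected, loopless multigraphs; adj u v is the number of edges
-- joining u and v.
record Graph : Set where
  field
    order     : ℕ
    adj       : Fin order → Fin order → ℕ
    symmetric : ∀ u v → adj u v ≡ adj v u
    loopless  : ∀ v → adj v v ≡ 0
    connected : ∀ u v → Star (λ x y → 0 < adj x y) u v

-- The star with n leaves; the centre is the vertex zero.
starAdj : ∀ n → Fin (suc n) → Fin (suc n) → ℕ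
starAdj n zero    zero    = 0
starAdj n zero    (suc _) = 1
starAdj n (suc _) zero    = 1
starAdj n (suc _) (suc _) = 0

star : ℕ → Graph
star n = record
  { order     = suc n
  ; adj       = starAdj n
  ; symmetric = λ { zero zero → refl ; zero (suc _) → refl
                  ; (suc _) zero → refl ; (suc _) (suc _) → refl }
  ; loopless  = λ { zero → refl ; (suc _) → refl }
  ; connected = λ { zero zero → ε
                  ; zero (suc _) → s≤s z≤n ◅ ε
                  ; (suc _) zero → s≤s z≤n ◅ ε
                  ; (suc _) (suc _) → _◅_ {j = zero} (s≤s z≤n) (s≤s z≤n ◅ ε) }
  }

completeAdj : ∀ n → Fin n → Fin n → ℕ
completeAdj n u v = if does (u ≟ v) then 0 else 1

complete : ℕ → Graph
complete n = record
  { order     = n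
  ; adj       = completeAdj n
  ; symmetric = symm
  ; loopless  = loop
  ; connected = conn
  }
  where
  symm : ∀ u v → completeAdj n u v ≡ completeAdj n v u
  symm u v with u ≟ v | v ≟ u
  ... | yes _   | yes _   = refl
  ... | yes u≡v | no v≢u  = contradiction (sym u≡v) v≢u
  ... | no u≢v  | yes v≡u = contradiction (sym v≡u) u≢v
  ... | no _    | no _    = refl

  loop : ∀ v → completeAdj n v v ≡ 0
  loop v with v ≟ v
  ... | yes _  = refl
  ... | no v≢v = contradiction refl v≢v

  edge : ∀ u v → u ≢ v → 0 < completeAdj n u v
  edge u v u≢v with u ≟ v
  ... | yes u≡v = contradiction u≡v u≢v
  ... | no _    = s≤s z≤n

  conn : ∀ u v → Star (λ x y → 0 < completeAdj n x y) u v
  conn u v with u ≟ v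
  ... | yes refl = ε
  ... | no u≢v   = edge u v u≢v ◅ ε

record ArithmeticalStructure (G : Graph) : Set where
  open Graph G
  field
    d        : Fin order → ℕ
    r        : Fin order → ℕ
    positive : ∀ v → 0 < r v
    coprime  : ∀ k → (∀ v → k ∣ r v) → k ≡ 1
    balanced : ∀ v → r v ℕ.* d v ≡ ∑ℕ.sum (λ u → adj v u ℕ.* r u)

Matrix : ℕ → Set
Matrix m = Fin m → Fin m → ℤ

infixr 7 _*ᵥ_
_*ᵥ_ : ∀ {m} → Matrix m → (Fin m → ℤ) → (Fin m → ℤ)
(M *ᵥ z) v = ∑ℤ.sum (λ u → M v u ℤ.* z u)

diag : ∀ {m} → (Fin m → ℤ) → Matrix m
diag x u v = if does (u ≟ v) then x u else + 0

private
  *ᵥ-zero : ∀ {m} (M : Matrix m) v → (M *ᵥ λ _ → + 0) v ≡ + 0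
  *ᵥ-zero {m} M v = trans
    (∑ℤ.sum-cong-≗ (λ u → ℤ.*-zeroʳ (M v u))) (∑ℤ.sum-replicate-zero m)

  *ᵥ-add : ∀ {m} (M : Matrix m) x y v →
           (M *ᵥ λ u → x u ℤ.+ y u) v ≡ (M *ᵥ x) v ℤ.+ (M *ᵥ y) v
  *ᵥ-add M x y v = trans
    (∑ℤ.sum-cong-≗ (λ u → ℤ.*-distribˡ-+ (M v u) (x u) (y u)))
    (∑ℤ.∑-distrib-+ (λ u → M v u ℤ.* x u) (λ u → M v u ℤ.* y u))

  *ᵥ-neg : ∀ {m} (M : Matrix m) x v →
           (M *ᵥ λ u → ℤ.- x u) v ≡ ℤ.- (M *ᵥ x) v
  *ᵥ-neg M x v = GroupProperties.inverseˡ-unique (AbelianGroup.group ℤ.+-0-abelianGroup) _ _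
    (trans (sym (*ᵥ-add M (λ u → ℤ.- x u) x v))
      (trans (∑ℤ.sum-cong-≗ (λ u → cong (M v u ℤ.*_) (ℤ.+-inverseˡ (x u))))
        (*ᵥ-zero M v)))

  split-neg : ∀ x y → y ℤ.- x ≡ ℤ.- (x ℤ.- y)
  split-neg = solve-∀

  split-trans : ∀ x y z → x ℤ.- z ≡ (x ℤ.- y) ℤ.+ (y ℤ.- z)
  split-trans = solve-∀

  split-add : ∀ x y u v → (x ℤ.+ u) ℤ.- (y ℤ.+ v) ≡ (x ℤ.- y) ℤ.+ (u ℤ.- v)
  split-add = solve-∀

  split-minus : ∀ x y → (ℤ.- x) ℤ.- (ℤ.- y) ≡ ℤ.- (x ℤ.- y)
  split-minus = solve-∀

-- The carrier is ℤᵐ, with equality taken modulo the image of M.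
cokernel : ∀ {m} → Matrix m → AbelianGroup 0ℓ 0ℓ
cokernel {m} M = record
  { Carrier = Fin m → ℤ
  ; _≈_     = _∼_
  ; _∙_     = λ x y v → x v ℤ.+ y v
  ; ε       = λ _ → + 0
  ; _⁻¹     = λ x v → ℤ.- x v
  ; isAbelianGroup = record
    { isGroup = record
      { isMonoid = record
        { isSemigroup = record
          { isMagma = record
            { isEquivalence = record
              { refl  = λ {x} → reflexive {x} (λ _ → refl)
              ; sym   = λ { {x} {y} (z , p) → (λ v → ℤ.- z v) , λ v →
                  trans (split-neg (x v) (y v))
                    (trans (cong ℤ.-_ (p v)) (sym (*ᵥ-neg M z v))) }
              ; trans = λ { {w} {x} {y} (z , p) (z′ , q) →
                  (λ v → z v ℤ.+ z′ v) , λ v →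
                  trans (split-trans (w v) (x v) (y v))
                    (trans (cong₂ ℤ._+_ (p v) (q v)) (sym (*ᵥ-add M z z′ v))) }
              }
            ; ∙-cong = λ { {x} {y} {u} {w} (z , p) (z′ , q) →
                (λ v → z v ℤ.+ z′ v) , λ v →
                trans (split-add (x v) (y v) (u v) (w v))
                  (trans (cong₂ ℤ._+_ (p v) (q v)) (sym (*ᵥ-add M z z′ v))) }
            }
          ; assoc = λ x y z → reflexive (ℤᵐ.assoc x y z)
          }
        ; identity = (λ x → reflexive (ℤᵐ.identityˡ x))
                   , (λ x → reflexive (ℤᵐ.identityʳ x))
        }
      ; inverse = (λ x → reflexive (ℤᵐ.inverseˡ x))
                , (λ x → reflexive (ℤᵐ.inverseʳ x))
      ; ⁻¹-cong = λ { {x} {y} (z , p) → (λ v → ℤ.- z v) , λ v →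
          trans (split-minus (x v) (y v))
            (trans (cong ℤ.-_ (p v)) (sym (*ᵥ-neg M z v))) }
      }
    ; comm = λ x y → reflexive (ℤᵐ.comm x y)
    }
  }
  where
  module ℤᵐ = AbelianGroup (Pointwise.abelianGroup (Fin m) ℤ.+-0-abelianGroup)

  _∼_ : (x y : Fin m → ℤ) → Set
  x ∼ y = ∃ λ z → ∀ v → x v ℤ.- y v ≡ (M *ᵥ z) v

  reflexive : ∀ {x y} → (∀ v → x v ≡ y v) → x ∼ y
  reflexive {x} {y} p = (λ _ → + 0) , λ v →
    trans (ℤ.i≡j⇒i-j≡0 (p v)) (sym (*ᵥ-zero M v))

torsionSubgroup : ∀ {c ℓ} → AbelianGroup c ℓ → AbelianGroup (c ⊔ ℓ) ℓ
torsionSubgroup {ℓ = ℓ} A = record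
  { Carrier = Σ Carrier Torsion
  ; _≈_     = λ x y → proj₁ x ≈ proj₁ y
  ; _∙_     = λ { (x , tx) (y , ty) → x ∙ y , torsion-∙ tx ty }
  ; ε       = ε₀ , 1 , s≤s z≤n , identityʳ ε₀
  ; _⁻¹     = λ { (x , tx) → x ⁻¹ , torsion-⁻¹ tx }
  ; isAbelianGroup = record
    { isGroup = record
      { isMonoid = record
        { isSemigroup = record
          { isMagma = record
            { isEquivalence = record
              { refl = A.refl ; sym = A.sym ; trans = A.trans }
            ; ∙-cong = ∙-cong
            }
          ; assoc = λ x y z → assoc (proj₁ x) (proj₁ y) (proj₁ z)
          }
        ; identity = (λ x → identityˡ (proj₁ x)) , (λ x → identityʳ (proj₁ x))
        }
      ; inverse = (λ x → inverseˡ (proj₁ x)) , (λ x → inverseʳ (proj₁ x))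
      ; ⁻¹-cong = ⁻¹-cong
      }
    ; comm = λ x y → comm (proj₁ x) (proj₁ y)
    }
  }
  where
  module A = AbelianGroup A
  open A using (Carrier; _≈_; _∙_; _⁻¹; ∙-cong; ⁻¹-cong; assoc; comm;
                identityˡ; identityʳ; inverseˡ; inverseʳ)
         renaming (ε to ε₀)
  open CommutativeMonoidMult A.commutativeMonoid
    renaming (_×_ to _⋆_; ×-congʳ to ⋆-congʳ; ×-congˡ to ⋆-congˡ;
              ×-assocˡ to ⋆-assocˡ; ×-distrib-+ to ⋆-distrib)

  Torsion : Carrier → Set ℓ
  Torsion x = ∃ λ n → 0 < n × n ⋆ x ≈ ε₀

  ⋆-ε : ∀ n → n ⋆ ε₀ ≈ ε₀
  ⋆-ε zero    = A.refl
  ⋆-ε (suc n) = A.trans (identityˡ _) (⋆-ε n)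

  ⋆-multiple : ∀ m {n x} → n ⋆ x ≈ ε₀ → (m ℕ.* n) ⋆ x ≈ ε₀
  ⋆-multiple m {n} {x} p =
    A.trans (A.sym (⋆-assocˡ x m n)) (A.trans (⋆-congʳ m p) (⋆-ε m))

  torsion-∙ : ∀ {x y} → Torsion x → Torsion y → Torsion (x ∙ y)
  torsion-∙ {x} {y} (m , 0<m , p) (n , 0<n , q) =
    m ℕ.* n , ℕ.*-mono-< 0<m 0<n ,
    A.trans (⋆-distrib x y (m ℕ.* n))
      (A.trans
        (∙-cong (A.trans (⋆-congˡ (ℕ.*-comm m n)) (⋆-multiple n p))
                (⋆-multiple m q))
        (identityˡ ε₀))

  torsion-⁻¹ : ∀ {x} → Torsion x → Torsion (x ⁻¹)
  torsion-⁻¹ {x} (n , 0<n , p) = n , 0<n ,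
    A.trans (A.sym (identityˡ _))
      (A.trans (∙-cong (A.sym p) A.refl)
        (A.trans (A.sym (⋆-distrib x (x ⁻¹) n))
          (A.trans (⋆-congʳ n (inverseʳ x)) (⋆-ε n))))

HasOrder : ∀ {c ℓ} → AbelianGroup c ℓ → ℕ → Set (c ⊔ ℓ)
HasOrder A k = Inverse (AbelianGroup.setoid A) (setoid (Fin k))

criticalGroup : ∀ {G} → ArithmeticalStructure G → AbelianGroup 0ℓ 0ℓ
criticalGroup {G} s =
  torsionSubgroup (cokernel λ u v → diag (λ w → + d w) u v ℤ.- + adj u v)
  where
  open Graph G
  open ArithmeticalStructure s

{-# OPTIONS --safe #-}
-- Let D be the vector of leaf values of d for the star, and d + 1 for the
-- complete graph.  In both cases Σ 1 / Dᵢ is an integer, and the critical group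
-- is the group of all y ∈ ∏ ℤ/Dᵢ with Σ yᵢ / Dᵢ ∈ ℤ modulo (1, …, 1).  Given two
-- coordinates u and v, a class has a representative with y_u = 0, and then y_v
-- is determined by the other coordinates; so the order of the group is at most
-- the product of all Dᵢ with i ≠ u , v.
--
-- Sort D increasingly and let u and v be the last two coordinates.  It remains
-- to bound D₁ ⋯ Dₙ₋₂.  Curtiss's theorem, in the form that the remainder
-- Σ_{i ≥ k} 1 / Dᵢ is at least 1 / aₖ, gives Dₖ ≤ (n - k + 1) aₖ, and
-- a₁ ⋯ aₙ₋₂ ≤ aₙ₋₂² since aₖ² < aₖ₊₁.  Curtiss's theorem is proved as by
-- Soundararajan: if the remainder at k is the first one below 1 / aₖ, then the
-- tail sums of 1 / D₁, …, 1 / Dₖ₋₁ dominate those of 1 / (aᵢ + 1), so by Abel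
-- summation and AM-GM, D₁ ⋯ Dₖ₋₁ ≤ ∏ (aᵢ + 1) = aₖ, while the remainder is a
-- positive multiple of 1 / (D₁ ⋯ Dₖ₋₁).
module Submission where

open import Defs
open import Algebra.Bundles using (AbelianGroup)
open import Data.Fin.Base using (Fin; zero; suc; toℕ; fromℕ<; punchIn)
open import Data.List.Base
  using (List; []; _∷_; map; length; lookup; upTo; deduplicate; cartesianProductWith;
         foldr; _++_; allFin; tabulate)
open import Data.List.Membership.Propositional using (_∈_)
open import Data.List.Membership.Propositional.Properties
  using (∈-upTo⁺; ∈-cartesianProductWith⁺; ∈-lookup; ∈-allFin; ∈-++⁻)
open import Data.List.Properties
  using (length-deduplicate; length-map; length-++; length-upTo; length-tabulate;
         map-tabulate; ++-identityʳ)
open import Data.List.Relation.Unary.Any using (here; there; index)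
open import Data.Nat.ListAction using (sum; product)
open import Data.Product.Base using (∃; _×_; _,_; proj₁; proj₂)
open import Data.Sum.Base using (_⊎_; inj₁; inj₂)
open import Function.Base using (const; _∘_)
open import Function.Bundles using (Inverse)
open import Relation.Binary.Bundles using (Setoid; DecSetoid)
open import Relation.Binary.PropositionalEquality hiding (decSetoid)

module CriticalGroups where

  import Algebra.Properties.CommutativeMonoid.Mult as CommutativeMonoidMult
  open import Data.Bool.Base using (if_then_else_)
  open import Data.Fin.Properties using (_≟_; any?; all?; toℕ-fromℕ<; punchInᵢ≢i)
  open import Data.Integer.Base using (ℤ; +_; _+_; _-_; _*_; -_; 0ℤ)
  open import Data.Integer.DivMod using (_%ℕ_; _/ℕ_; a≡a%ℕn+[a/ℕn]*n; n%ℕd<d)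
  open import Data.Integer.Divisibility.Signed
  open import Data.Integer.Properties
    using (+-identityʳ; +-injective; *-assoc; *-comm; *-identityˡ; *-zeroˡ; *-zeroʳ; *-cancelˡ-≡;
           i≡j⇒i-j≡0; i-j≡0⇒i≡j; neg-distribʳ-*; neg-involutive; pos-+; pos-*)
  open import Data.Integer.Tactic.RingSolver using (solve-∀)
  import Data.List.Membership.Setoid as SetoidMembership
  import Data.List.Membership.Setoid.Properties as SetoidMembershipₚ
  import Data.List.Relation.Unary.All as All
  open import Data.List.Relation.Unary.AllPairs using ([]; _∷_)
  open import Data.List.Relation.Unary.Any.Properties using (lookup-index)
  open import Data.List.Relation.Unary.Unique.DecSetoid.Properties using (deduplicate-!)
  import Data.List.Relation.Unary.Unique.Setoid as SetoidUnique
  open import Data.Nat.Base as ℕ using (ℕ; zero; suc; _<_; _≤_; NonZero; >-nonZero)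
  import Data.Nat.Divisibility as ℕ
  import Data.Nat.Properties as ℕ
  open import Data.Vec.Functional using (updateAt; removeAt)
  open import Data.Vec.Functional.Properties using (updateAt-updates; updateAt-minimal)
  open import Level using (0ℓ)
  open import Relation.Nullary using (Dec; yes; no; does; contradiction)
  open import Relation.Nullary.Decidable using (map′)

  -- Finite setoids from enumerations.

  module _ {c ℓ} (S : Setoid c ℓ) where
    open Setoid S using (_≈_) renaming (sym to ≈-sym)
    open SetoidUnique S using (Unique)

    ∈-map-≈ : ∀ {i} {A : Set i} (g : A → Setoid.Carrier S) {y ys x} → y ∈ ys → x ≈ g y →
      SetoidMembership._∈_ S x (map g ys)
    ∈-map-≈ g (here refl) x≈ = here x≈
    ∈-map-≈ g (there y∈)  x≈ = there (∈-map-≈ g y∈ x≈)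

    lookup-injective : ∀ {xs} → Unique xs → ∀ i j → lookup xs i ≈ lookup xs j → i ≡ j
    lookup-injective (x≉ ∷ xs!) zero    zero    _ = refl
    lookup-injective {xs = _ ∷ xs} (x≉ ∷ xs!) zero    (suc j) p =
      contradiction p (All.lookup x≉ (∈-lookup {xs = xs} j))
    lookup-injective {xs = _ ∷ xs} (x≉ ∷ xs!) (suc i) zero    p =
      contradiction (≈-sym p) (All.lookup x≉ (∈-lookup {xs = xs} i))
    lookup-injective (x≉ ∷ xs!) (suc i) (suc j) p = cong suc (lookup-injective xs! i j p)

  module _ {c ℓ} (DS : DecSetoid c ℓ) where
    open DecSetoid DS renaming (setoid to S; _≟_ to _≈?_; refl to ≈-refl; sym to ≈-sym; trans to ≈-trans)
    open SetoidMembership S renaming (_∈_ to _∈ₛ_)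

    -- Repetitions in `xs` are harmless: decidable equality allows them to be removed, and positions
    -- in the shortened list then number the classes.
    enumeration⇒finite : ∀ xs → (∀ x → x ∈ₛ xs) →
      ∃ λ k → Inverse S (setoid (Fin k)) × k ≤ length xs
    enumeration⇒finite xs complete = length ys , record
      { to        = λ x → index (complete′ x)
      ; from      = lookup ys
      ; to-cong   = λ {x} {y} x≈y → to-unique x (≈-trans x≈y (lookup-index (complete′ y)))
      ; from-cong = λ { refl → ≈-refl }
      ; inverse   = (λ { {x = i} x≈ → to-unique _ x≈ })
                  , (λ { {x = x} refl → ≈-sym (lookup-index (complete′ x)) })
      } , length-deduplicate _≈?_ xs
      where
      ys = deduplicate _≈?_ xs
      complete′ : ∀ x → x ∈ₛ ys
      complete′ x = SetoidMembershipₚ.∈-deduplicate⁺ S _≈?_ (λ p q → ≈-trans q (≈-sym p)) (complete x)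
      to-unique : ∀ x {i} → x ≈ lookup ys i → index (complete′ x) ≡ i
      to-unique x {i} x≈ = lookup-injective S (deduplicate-! DS xs) _ i
        (≈-trans (≈-sym (lookup-index (complete′ x))) x≈)

  -- Integer sums and divisibility.

  ∑ : ∀ {n} → (Fin n → ℤ) → ℤ
  ∑ = ∑ℤ.sum

  ∑-+ : ∀ {n} (f g : Fin n → ℤ) → ∑ (λ i → f i + g i) ≡ ∑ f + ∑ g
  ∑-+ = ∑ℤ.∑-distrib-+

  ∑-cong : ∀ {n} {f g : Fin n → ℤ} → (∀ i → f i ≡ g i) → ∑ f ≡ ∑ g
  ∑-cong = ∑ℤ.sum-cong-≗

  ∑-*ˡ : ∀ {n} c (f : Fin n → ℤ) → ∑ (λ i → c * f i) ≡ c * ∑ f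
  ∑-*ˡ c f = sym (∑ℤ.*-distribˡ-sum c f)

  ∑-*ʳ : ∀ {n} (f : Fin n → ℤ) c → ∑ (λ i → f i * c) ≡ ∑ f * c
  ∑-*ʳ f c = sym (∑ℤ.*-distribʳ-sum c f)

  ∑-single : ∀ {n} (f : Fin n → ℤ) v → (∀ i → i ≢ v → f i ≡ 0ℤ) → ∑ f ≡ f v
  ∑-single {suc n} f v off = begin
    ∑ f                     ≡⟨ ∑ℤ.sum-remove {i = v} f ⟩
    f v + ∑ (removeAt f v)  ≡⟨ cong (_+_ (f v)) (∑-cong (λ i → off (punchIn v i) (punchInᵢ≢i v i))) ⟩
    f v + ∑ {n} (const 0ℤ)  ≡⟨ cong (_+_ (f v)) (∑ℤ.sum-replicate-zero n) ⟩
    f v + 0ℤ                ≡⟨ +-identityʳ (f v) ⟩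
    f v                     ∎
    where open ≡-Reasoning

  ∣-∑ : ∀ {n k} (f : Fin n → ℤ) → (∀ i → k ∣ f i) → k ∣ ∑ f
  ∣-∑ {zero}  f p = divides 0ℤ refl
  ∣-∑ {suc n} f p = ∣m∣n⇒∣m+n (p zero) (∣-∑ (f ∘ suc) (p ∘ suc))

  pos-∑ : ∀ {n} (f : Fin n → ℕ) → + ∑ℕ.sum f ≡ ∑ (λ i → + f i)
  pos-∑ {zero}  f = refl
  pos-∑ {suc n} f = trans (pos-+ (f zero) _) (cong (_+_ (+ f zero)) (pos-∑ (f ∘ suc)))

  ∣-[-%ℕ] : ∀ x d .{{_ : NonZero d}} → + d ∣ x - + (x %ℕ d)
  ∣-[-%ℕ] x d = divides (x /ℕ d) (trans
    (cong (_- + (x %ℕ d)) (a≡a%ℕn+[a/ℕn]*n x d))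
    (lemma (+ (x %ℕ d)) (x /ℕ d) (+ d)))
    where
    lemma : ∀ m q d → m + q * d - m ≡ q * d
    lemma = solve-∀

  length-cartesianProductWith : ∀ {A B C : Set} (f : A → B → C) xs ys →
    length (cartesianProductWith f xs ys) ≡ length xs ℕ.* length ys
  length-cartesianProductWith f []       ys = refl
  length-cartesianProductWith f (x ∷ xs) ys = trans (length-++ (map (f x) ys))
    (cong₂ ℕ._+_ (length-map (f x) ys) (length-cartesianProductWith f xs ys))

  -- Enumeration of bounded functions.

  module _ {n} (D : Fin n → ℕ) where

    -- Functions on all of `Fin n` stand for tuples indexed by the list; positions outside it hold
    -- the default 0.
    boundedFunctions : List (Fin n) → List (Fin n → ℕ)
    boundedFunctions []       = const 0 ∷ []
    boundedFunctions (i ∷ is) =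
      cartesianProductWith (λ c f → updateAt f i (const c)) (upTo (D i)) (boundedFunctions is)

    length-boundedFunctions : ∀ is → length (boundedFunctions is) ≡ product (map D is)
    length-boundedFunctions []       = refl
    length-boundedFunctions (i ∷ is) = trans
      (length-cartesianProductWith _ (upTo (D i)) (boundedFunctions is))
      (cong₂ ℕ._*_ (length-upTo (D i)) (length-boundedFunctions is))

    boundedFunctions-complete : ∀ (x : Fin n → ℕ) → (∀ i → x i < D i) → ∀ is →
      ∃ λ f → f ∈ boundedFunctions is × (∀ {j} → j ∈ is → f j ≡ x j)
    boundedFunctions-complete x x<D []       = const 0 , here refl , λ ()
    boundedFunctions-complete x x<D (i ∷ is) with boundedFunctions-complete x x<D is
    ... | f , f∈ , agree =
      updateAt f i (const (x i)) , ∈-cartesianProductWith⁺ _ (∈-upTo⁺ (x<D i)) f∈ , agree′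
      where
      agree′ : ∀ {j} → j ∈ i ∷ is → updateAt f i (const (x i)) j ≡ x j
      agree′ {j} j∈ with j ≟ i
      ... | yes refl = updateAt-updates i f
      ... | no j≢i with j∈
      ...   | here j≡i   = contradiction j≡i j≢i
      ...   | there j∈is = trans (updateAt-minimal j i f j≢i) (agree j∈is)

  -- The group of residues.

  module Residues {n} (D r : Fin n → ℕ) (R : ℕ) (0<R : 0 < R)
    (r*D≡R : ∀ i → r i ℕ.* D i ≡ R) (R∣∑r : R ℕ.∣ ∑ℕ.sum r) where

    -- As `r i` is R / Dᵢ, this is R · Σ yᵢ / Dᵢ, so divisibility by `R` expresses that Σ yᵢ / Dᵢ is
    -- an integer.
    weight : (Fin n → ℤ) → ℤ
    weight y = ∑ (λ i → + r i * y i)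

    R≢0 : NonZero R
    R≢0 = >-nonZero 0<R

    D≢0 : ∀ i → NonZero (D i)
    D≢0 i = ℕ.m*n≢0⇒n≢0 (r i) {{subst NonZero (sym (r*D≡R i)) R≢0}}

    r≢0 : ∀ i → NonZero (r i)
    r≢0 i = ℕ.m*n≢0⇒m≢0 (r i) {{subst NonZero (sym (r*D≡R i)) R≢0}}

    rD≡R : ∀ i → + r i * + D i ≡ + R
    rD≡R i = trans (sym (pos-* (r i) (D i))) (cong +_ (r*D≡R i))

    D∣R : ∀ i → + D i ∣ + R
    D∣R i = divides (+ r i) (sym (rD≡R i))

    weight-+ : ∀ x y → weight (λ i → x i + y i) ≡ weight x + weight y
    weight-+ x y = trans (∑-cong (λ i → distrib (+ r i) (x i) (y i)))
      (∑-+ (λ i → + r i * x i) (λ i → + r i * y i))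
      where
      distrib : ∀ r x y → r * (x + y) ≡ r * x + r * y
      distrib = solve-∀

    weight-const : ∀ c → weight (const c) ≡ + ∑ℕ.sum r * c
    weight-const c = trans (∑-*ʳ (λ i → + r i) c) (cong (_* c) (sym (pos-∑ r)))

    R∣weight-const : ∀ c → + R ∣ weight (const c)
    R∣weight-const c = subst (+ R ∣_) (sym (weight-const c)) (∣m⇒∣m*n c (∣ᵤ⇒∣ {+ R} {+ ∑ℕ.sum r} R∣∑r))

    R∣weight-multiples : ∀ x → (∀ i → + D i ∣ x i) → + R ∣ weight x
    R∣weight-multiples x D∣x = ∣-∑ _ λ i → subst (_∣ + r i * x i) (rD≡R i) (*-monoʳ-∣ (+ r i) (D∣x i))

    -- The last argument is the multiple of (1, ..., 1) by which the two representatives differ.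
    Congruent : (x y : Fin n → ℤ) → ℤ → Set
    Congruent x y c = ∀ i → + D i ∣ x i - y i + c

    weight-cong : ∀ {x y} → (∀ i → x i ≡ y i) → weight x ≡ weight y
    weight-cong p = ∑-cong (λ i → cong (+ r i *_) (p i))

    -- Adding a constant changes the weight by a multiple of Σ r, and adding multiples of the Dᵢ
    -- changes it by a multiple of `R`.
    weight-respects : ∀ x y c → Congruent x y c → + R ∣ weight x → + R ∣ weight y
    weight-respects x y c x∼y R∣x = ∣m+n∣m⇒∣n
      (subst (+ R ∣_) eq (∣m∣n⇒∣m+n R∣x (R∣weight-const c)))
      (R∣weight-multiples (λ i → x i - y i + c) x∼y)
      where
      lemma : ∀ x y c → x + c ≡ (x - y + c) + y
      lemma = solve-∀
      eq : weight x + weight (const c) ≡ weight (λ i → x i - y i + c) + weight y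
      eq = trans (sym (weight-+ x (const c)))
        (trans (weight-cong (λ i → lemma (x i) (y i) c)) (weight-+ _ y))

    Carrier : Set
    Carrier = ∃ λ y → + R ∣ weight y

    _≈_ : (x y : Carrier) → Set
    (x , _) ≈ (y , _) = ∃ (Congruent x y)

    congruent-reflexive : ∀ {x y} → (∀ i → x i ≡ y i) → Congruent x y 0ℤ
    congruent-reflexive p i = divides 0ℤ (trans (+-identityʳ _) (i≡j⇒i-j≡0 (p i)))

    congruent-sym : ∀ {x y c} → Congruent x y c → Congruent y x (- c)
    congruent-sym {x} {y} {c} p i = subst (+ D i ∣_) (lemma (x i) (y i) c) (∣m⇒∣-m (p i))
      where
      lemma : ∀ x y c → - (x - y + c) ≡ y - x + (- c)
      lemma = solve-∀

    congruent-trans : ∀ {x y z c c′} → Congruent x y c → Congruent y z c′ → Congruent x z (c + c′)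
    congruent-trans {x} {y} {z} {c} {c′} p q i =
      subst (+ D i ∣_) (lemma (x i) (y i) (z i) c c′) (∣m∣n⇒∣m+n (p i) (q i))
      where
      lemma : ∀ x y z c c′ → (x - y + c) + (y - z + c′) ≡ x - z + (c + c′)
      lemma = solve-∀

    congruent-mod : ∀ {x y c c′} → Congruent x y c → + R ∣ c - c′ → Congruent x y c′
    congruent-mod {x} {y} {c} {c′} p R∣ i = subst (+ D i ∣_) (lemma (x i) (y i) c c′)
      (∣m∣n⇒∣m-n (p i) (∣-trans (D∣R i) R∣))
      where
      lemma : ∀ x y c c′ → (x - y + c) - (c - c′) ≡ x - y + c′
      lemma = solve-∀

    -- Every Dᵢ divides `R`, so the shift matters only modulo `R` and a finite search decides.
    _≈?_ : ∀ x y → Dec (x ≈ y)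
    (x , _) ≈? (y , _) = map′ (λ (c , p) → + toℕ c , p) reduce
      (any? λ (c : Fin R) → all? λ i → + D i ∣? x i - y i + + toℕ c)
      where
      reduce : ∃ (Congruent x y) → ∃ λ (c : Fin R) → Congruent x y (+ toℕ c)
      reduce (c , p) = fromℕ< c<R , subst (λ k → Congruent x y (+ k)) (sym (toℕ-fromℕ< c<R))
        (congruent-mod {x} {y} p (∣-[-%ℕ] c R {{R≢0}}))
        where c<R = n%ℕd<d c R {{R≢0}}

    decSetoid : DecSetoid 0ℓ 0ℓ
    decSetoid = record
      { Carrier = Carrier
      ; _≈_     = _≈_
      ; isDecEquivalence = record
        { isEquivalence = record
          { refl  = λ { {x , _} → 0ℤ , congruent-reflexive {x} (λ _ → refl) }
          ; sym   = λ { {x , _} {y , _} (c , p) → - c , congruent-sym {x} {y} p }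
          ; trans = λ { {x , _} {y , _} {z , _} (c , p) (c′ , q) → c + c′ , congruent-trans {x} {y} {z} p q }
          }
        ; _≟_ = _≈?_
        }
      }

    zeroElement : Carrier
    zeroElement = const 0ℤ , R∣weight-const 0ℤ

    weight-D* : ∀ z → weight (λ i → + D i * z i) ≡ + R * ∑ z
    weight-D* z = trans
      (∑-cong λ i → trans (sym (*-assoc (+ r i) (+ D i) (z i))) (cong (_* z i) (rD≡R i)))
      (∑-*ˡ (+ R) z)

    weight-D*- : ∀ z c → weight (λ i → + D i * z i - c) ≡ + R * ∑ z - + ∑ℕ.sum r * c
    weight-D*- z c = trans (weight-+ (λ i → + D i * z i) (const (- c)))
      (cong₂ _+_ (weight-D* z) (trans (weight-const (- c)) (sym (neg-distribʳ-* (+ ∑ℕ.sum r) c))))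

    -- The quotients `z` of a congruence will be coordinates of a preimage under the matrix of the
    -- graph, whose rows also involve their sum. Taking weights in the congruences and cancelling
    -- `R` yields that sum.
    sum-quotients : ∀ e → ∑ℕ.sum r ≡ R ℕ.* e → ∀ x y {q q′} c z →
      weight x ≡ q * + R → weight y ≡ q′ * + R → (∀ i → x i - y i + c ≡ z i * + D i) →
      ∑ z ≡ q - q′ + + e * c
    sum-quotients e ∑r≡ x y {q} {q′} c z wx wy p = *-cancelˡ-≡ (+ R) _ _ {{R≢0}} (begin
      + R * ∑ z                                ≡⟨ weight-D* z ⟨
      weight (λ i → + D i * z i)               ≡⟨ cancel (weight (λ i → + D i * z i)) (weight y) ⟩
      weight (λ i → + D i * z i) + weight y - weight y
        ≡⟨ cong (_- weight y) (trans (sym (weight-+ (λ i → + D i * z i) y))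
            (trans (weight-cong p′) (weight-+ x (const c)))) ⟩
      weight x + weight (const c) - weight y
        ≡⟨ cong₂ _-_ (cong₂ _+_ wx (trans (weight-const c)
            (cong (_* c) (trans (cong +_ ∑r≡) (pos-* R e))))) wy ⟩
      q * + R + + R * + e * c - q′ * + R       ≡⟨ lemma q q′ (+ R) (+ e) c ⟩
      + R * (q - q′ + + e * c)                 ∎)
      where
      open ≡-Reasoning
      cancel : ∀ w v → w ≡ w + v - v
      cancel = solve-∀
      lemma : ∀ q q′ R e c → q * R + R * e * c - q′ * R ≡ R * (q - q′ + e * c)
      lemma = solve-∀
      lemma′ : ∀ x y c → (x - y + c) + y ≡ x + c
      lemma′ = solve-∀
      p′ : ∀ i → + D i * z i + y i ≡ x i + c
      p′ i = trans (cong (_+ y i) (trans (*-comm (+ D i) (z i)) (sym (p i)))) (lemma′ (x i) (y i) c)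

    -- Counting residue classes with two coordinates omitted.

    module _ (u v : Fin n) (is : List (Fin n)) (cover : ∀ i → i ≡ u ⊎ i ≡ v ⊎ i ∈ is) where

      -- The test for `u` comes first, so `c` has an effect only if `u` and `v` differ; hence the
      -- condition `u ≢ v` in the lemmas below.
      assemble : (Fin n → ℕ) → ℕ → Fin n → ℤ
      assemble f c i = if does (i ≟ u) then 0ℤ else if does (i ≟ v) then + c else + f i

      Solution : (Fin n → ℕ) → Set
      Solution f = ∃ λ (c : Fin (D v)) → + R ∣ weight (assemble f (toℕ c))

      solution? : ∀ f → Dec (Solution f)
      solution? f = any? λ c → + R ∣? weight (assemble f (toℕ c))

      -- An `f` without completion is sent to the zero class: the candidates only have to cover the
      -- group, and duplicates are removed later.
      fromSolution : ∀ {f} → Dec (Solution f) → Carrier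
      fromSolution {f} (yes (c , R∣)) = assemble f (toℕ c) , R∣
      fromSolution     (no _)         = zeroElement

      candidate : (Fin n → ℕ) → Carrier
      candidate f = fromSolution (solution? f)

      -- The two vectors differ only at `v`, so `R`, which is `r v` times `D v`, divides `r v` times
      -- the difference; cancel `r v`.
      solution-unique : ∀ f c c′ → u ≢ v → + R ∣ weight (assemble f c) → + R ∣ weight (assemble f c′) →
        + D v ∣ + c - + c′
      solution-unique f c c′ u≢v R∣c R∣c′ = *-cancelˡ-∣ (+ r v) {{r≢0 v}} (subst₂ _∣_ (sym (rD≡R v)) eq
        (∣m∣n⇒∣m-n R∣c R∣c′))
        where
        y  = assemble f c
        y′ = assemble f c′
        off : ∀ i → i ≢ v → + r i * (y i - y′ i) ≡ 0ℤ
        off i i≢v with i ≟ u | i ≟ v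
        ... | yes _ | _       = *-zeroʳ (+ r i)
        ... | no _  | yes i≡v = contradiction i≡v i≢v
        ... | no _  | no _    = trans (cong (+ r i *_) (i≡j⇒i-j≡0 {+ f i} refl)) (*-zeroʳ (+ r i))
        at-v : y v - y′ v ≡ + c - + c′
        at-v with v ≟ u | v ≟ v
        ... | yes v≡u | _      = contradiction (sym v≡u) u≢v
        ... | no _    | yes _  = refl
        ... | no _    | no v≢v = contradiction refl v≢v
        lemma : ∀ w x → (w - x) + x ≡ w
        lemma = solve-∀
        lemma′ : ∀ w x → w + x - x ≡ w
        lemma′ = solve-∀
        eq : weight y - weight y′ ≡ + r v * (+ c - + c′)
        eq = begin
          weight y - weight y′
            ≡⟨ cong (_- weight y′) (trans (weight-cong (λ i → sym (lemma (y i) (y′ i))))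
                (weight-+ (λ i → y i - y′ i) y′)) ⟩
          weight (λ i → y i - y′ i) + weight y′ - weight y′ ≡⟨ lemma′ (weight (λ i → y i - y′ i)) (weight y′) ⟩
          weight (λ i → y i - y′ i)                         ≡⟨ ∑-single _ v off ⟩
          + r v * (y v - y′ v)                              ≡⟨ cong (+ r v *_) at-v ⟩
          + r v * (+ c - + c′)                              ∎
          where open ≡-Reasoning

      module _ (x : Fin n → ℤ) (R∣x : + R ∣ weight x) where

        -- Subtracting the constant `x u` moves to the representative of the class that vanishes at
        -- `u`.
        residue : Fin n → ℕ
        residue i = _%ℕ_ (x i - x u) (D i) {{D≢0 i}}

        residue-∣ : ∀ i → + D i ∣ x i - + residue i + - x u
        residue-∣ i = subst (+ D i ∣_) (lemma (x i) (x u) (+ residue i))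
          (∣-[-%ℕ] (x i - x u) (D i) {{D≢0 i}})
          where
          lemma : ∀ x c m → x - c - m ≡ x - m + - c
          lemma = solve-∀

        assemble-congruent : ∀ f c → (∀ {j} → j ∈ is → f j ≡ residue j) →
          (u ≢ v → + D v ∣ + c - + residue v) → Congruent x (assemble f c) (- x u)
        assemble-congruent f c agree D∣c i with i ≟ u | i ≟ v | cover i
        ... | yes refl | _ | _                   = divides 0ℤ (lemma (x i))
          where
          lemma : ∀ x → x - 0ℤ + - x ≡ 0ℤ
          lemma = solve-∀
        ... | no i≢u | yes refl | _              = subst (+ D i ∣_) (lemma (x i) (x u) (+ c) (+ residue i))
                                                      (∣m∣n⇒∣m-n (residue-∣ i) (D∣c (i≢u ∘ sym)))
          where
          lemma : ∀ x xu c m → (x - m + - xu) - (c - m) ≡ x - c + - xu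
          lemma = solve-∀
        ... | no i≢u | no i≢v | inj₁ i≡u         = contradiction i≡u i≢u
        ... | no i≢u | no i≢v | inj₂ (inj₁ i≡v)  = contradiction i≡v i≢v
        ... | no i≢u | no i≢v | inj₂ (inj₂ i∈is) =
          subst (λ m → + D i ∣ x i - + m + - x u) (sym (agree i∈is)) (residue-∣ i)

        -- The residue of `x` at `v` completes `f`, since weights respect congruence; so the search
        -- cannot fail, and by uniqueness whatever it finds agrees with that residue modulo `D v`.
        ≈-fromSolution : ∀ f → (∀ {j} → j ∈ is → f j ≡ residue j) →
          (s : Dec (Solution f)) → (x , R∣x) ≈ fromSolution s
        ≈-fromSolution f agree = go
          where
          R∣residue : + R ∣ weight (assemble f (residue v))
          R∣residue = weight-respects x _ (- x u)
            (assemble-congruent f (residue v) agree (λ _ → divides 0ℤ (i≡j⇒i-j≡0 {+ residue v} refl))) R∣x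
          go : (s : Dec (Solution f)) → (x , R∣x) ≈ fromSolution s
          go (yes (c , R∣c)) = - x u , assemble-congruent f (toℕ c) agree
            (λ u≢v → solution-unique f (toℕ c) (residue v) u≢v R∣c R∣residue)
          go (no ¬solution)  = contradiction
            (fromℕ< v<D , subst (λ c → + R ∣ weight (assemble f c)) (sym (toℕ-fromℕ< v<D)) R∣residue) ¬solution
            where v<D = n%ℕd<d (x v - x u) (D v) {{D≢0 v}}

      open SetoidMembership (DecSetoid.setoid decSetoid) renaming (_∈_ to _∈ₛ_)

      candidates : List Carrier
      candidates = map candidate (boundedFunctions D is)

      candidates-complete : ∀ x → x ∈ₛ candidates
      candidates-complete (x , R∣x) = covered
        (boundedFunctions-complete D (residue x R∣x) (λ i → n%ℕd<d (x i - x u) (D i) {{D≢0 i}}) is)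
        where
        covered : (∃ λ f → f ∈ boundedFunctions D is × (∀ {j} → j ∈ is → f j ≡ residue x R∣x j)) →
                  (x , R∣x) ∈ₛ candidates
        covered (f , f∈ , agree) = ∈-map-≈ (DecSetoid.setoid decSetoid) candidate {x = x , R∣x} f∈
          (≈-fromSolution x R∣x f agree (solution? f))

      length-candidates : length candidates ≡ product (map D is)
      length-candidates = trans (length-map candidate (boundedFunctions D is)) (length-boundedFunctions D is)

      finite : ∃ λ k → Inverse (DecSetoid.setoid decSetoid) (setoid (Fin k)) × k ≤ product (map D is)
      finite = subst (λ l → ∃ λ k → Inverse (DecSetoid.setoid decSetoid) (setoid (Fin k)) × k ≤ l)
        length-candidates (enumeration⇒finite decSetoid candidates candidates-complete)

  -- Torsion in the cokernel of an integer matrix.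

  strictInverse : ∀ {a b ℓ₁ ℓ₂} (S : Setoid a ℓ₁) (T : Setoid b ℓ₂) →
    (to : Setoid.Carrier S → Setoid.Carrier T) (from : Setoid.Carrier T → Setoid.Carrier S) →
    (∀ {x y} → Setoid._≈_ S x y → Setoid._≈_ T (to x) (to y)) →
    (∀ {x y} → Setoid._≈_ T x y → Setoid._≈_ S (from x) (from y)) →
    (∀ y → Setoid._≈_ T (to (from y)) y) → (∀ x → Setoid._≈_ S (from (to x)) x) → Inverse S T
  strictInverse S T to from to-cong from-cong to∘from from∘to = record
    { to        = to
    ; from      = from
    ; to-cong   = to-cong
    ; from-cong = from-cong
    ; inverse   = (λ {x} p → Setoid.trans T (to-cong p) (to∘from x))
                , (λ {x} p → Setoid.trans S (from-cong p) (from∘to x))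
    }

  ∑-diag : ∀ {n} (d z : Fin n → ℤ) i → ∑ (λ j → diag d i j * z j) ≡ d i * z i
  ∑-diag d z i = trans (∑-single _ i off) (cong (_* z i) on)
    where
    off : ∀ j → j ≢ i → diag d i j * z j ≡ 0ℤ
    off j j≢i with i ≟ j
    ... | yes i≡j = contradiction (sym i≡j) j≢i
    ... | no _    = refl
    on : diag d i i ≡ d i
    on with i ≟ i
    ... | yes _  = refl
    ... | no i≢i = contradiction refl i≢i

  ∑-neg : ∀ {n} (f : Fin n → ℤ) → ∑ (λ i → - f i) ≡ - ∑ f
  ∑-neg f = trans (∑-cong (λ i → lemma (f i))) (trans (∑-*ˡ (- + 1) f) (sym (lemma (∑ f))))
    where
    lemma : ∀ x → - x ≡ (- + 1) * x
    lemma = solve-∀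

  module _ {m} (M : Matrix m) where
    open AbelianGroup (cokernel M) using (_≈_; commutativeMonoid; ε)
    open CommutativeMonoidMult commutativeMonoid using () renaming (_×_ to _⋆_)

    ⋆-pointwise : ∀ k x v → (k ⋆ x) v ≡ + k * x v
    ⋆-pointwise zero    x v = sym (*-zeroˡ (x v))
    ⋆-pointwise (suc k) x v = trans (cong (_+_ (x v)) (⋆-pointwise k x v)) (lemma (x v) (+ k))
      where
      lemma : ∀ x k → x + k * x ≡ (+ 1 + k) * x
      lemma = solve-∀

    Torsion : (Fin m → ℤ) → Set
    Torsion x = ∃ λ k → 0 < k × (k ⋆ x) ≈ ε

    torsion⇒image : ∀ {x} → Torsion x → ∃ λ k → NonZero k × ∃ λ z → ∀ v → + k * x v ≡ (M *ᵥ z) v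
    torsion⇒image {x} (k , 0<k , z , p) = k , >-nonZero 0<k , z , λ v →
      trans (sym (⋆-pointwise k x v)) (trans (sym (+-identityʳ _)) (p v))

    image⇒torsion : ∀ {x} k → 0 < k → ∀ z → (∀ v → + k * x v ≡ (M *ᵥ z) v) → Torsion x
    image⇒torsion {x} k 0<k z p = k , 0<k , z , λ v →
      trans (+-identityʳ _) (trans (⋆-pointwise k x v) (p v))

    ≗⇒≈ : ∀ {x y} → (∀ v → x v ≡ y v) → x ≈ y
    ≗⇒≈ {x} {y} p = proj₁ (refl-y) , λ v → trans (cong (_- y v) (p v)) (proj₂ refl-y v)
      where refl-y = AbelianGroup.refl (cokernel M) {y}

  -- The critical group of a star.

  module StarGroup {n} (s : ArithmeticalStructure (star n)) where
    open ArithmeticalStructure s renaming (d to dₛ; r to rₛ)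

    D r : Fin n → ℕ
    D i = dₛ (suc i)
    r i = rₛ (suc i)
    R e : ℕ
    R = rₛ zero
    e = dₛ zero

    r*D≡R : ∀ i → r i ℕ.* D i ≡ R
    r*D≡R i = trans (balanced (suc i)) (trans
      (cong₂ ℕ._+_ (ℕ.*-identityˡ R) (∑ℕ.sum-replicate-zero n)) (ℕ.+-identityʳ R))

    ∑r≡R*e : ∑ℕ.sum r ≡ R ℕ.* e
    ∑r≡R*e = sym (trans (balanced zero) (∑ℕ.sum-cong-≗ (λ i → ℕ.*-identityˡ (r i))))

    R∣∑r : R ℕ.∣ ∑ℕ.sum r
    R∣∑r = subst (R ℕ.∣_) (sym ∑r≡R*e) (ℕ.m∣m*n e)

    open Residues D r R (positive zero) r*D≡R R∣∑r

    M : Matrix (suc n)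
    M u v = diag (λ w → + dₛ w) u v - + starAdj n u v

    row-zero : ∀ z → (M *ᵥ z) zero ≡ + e * z zero - ∑ (z ∘ suc)
    row-zero z = cong₂ _+_ (cong (_* z zero) (+-identityʳ (+ e)))
      (trans (∑-cong (λ i → lemma (z (suc i)))) (∑-neg (z ∘ suc)))
      where
      lemma : ∀ x → (0ℤ - + 1) * x ≡ - x
      lemma = solve-∀

    row-suc : ∀ z i → (M *ᵥ z) (suc i) ≡ + D i * z (suc i) - z zero
    row-suc z i = trans (cong₂ _+_ (lemma (z zero))
      (trans (∑-cong (λ j → cong (_* z (suc j)) (+-identityʳ (diag (λ i → + D i) i j))))
        (∑-diag (λ i → + D i) (z ∘ suc) i)))
      (lemma′ (z zero) (+ D i * z (suc i)))
      where
      lemma : ∀ x → (0ℤ - + 1) * x ≡ - x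
      lemma = solve-∀
      lemma′ : ∀ x y → - x + y ≡ y - x
      lemma′ = solve-∀

    -- The matrix is symmetric and kills the vector `rₛ`, so `rₛ` is orthogonal to its image, and to
    -- every torsion element after cancelling `k`. The leaves thus determine the coordinate at the
    -- centre.
    torsion-weight : ∀ {x} → Torsion M x → weight (x ∘ suc) ≡ - x zero * + R
    torsion-weight {x} t with torsion⇒image M {x} t
    ... | k , k≢0 , z , p = i-j≡0⇒i≡j _ _ (*-cancelˡ-≡ (+ k) _ _ {{k≢0}} (begin
      + k * (weight (x ∘ suc) - - x zero * + R)           ≡⟨ lemma₁ (+ k) (weight (x ∘ suc)) (x zero) (+ R) ⟩
      + k * weight (x ∘ suc) + + R * (+ k * x zero)
        ≡⟨ cong₂ (λ u v → u + + R * v) scaled (trans (p zero) (row-zero z)) ⟩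
      weight (λ i → + D i * z (suc i) - z zero) + + R * (+ e * z zero - ∑ (z ∘ suc))
        ≡⟨ cong (_+ + R * (+ e * z zero - ∑ (z ∘ suc))) (trans (weight-D*- (z ∘ suc) (z zero))
            (cong (λ w → + R * ∑ (z ∘ suc) - w * z zero) (trans (cong +_ ∑r≡R*e) (pos-* R e)))) ⟩
      (+ R * ∑ (z ∘ suc) - + R * + e * z zero) + + R * (+ e * z zero - ∑ (z ∘ suc))
        ≡⟨ lemma₂ (+ R) (+ e) (z zero) (∑ (z ∘ suc)) (+ k) ⟩
      + k * 0ℤ ∎))
      where
      open ≡-Reasoning
      lemma₁ : ∀ k w x R → k * (w - - x * R) ≡ k * w + R * (k * x)
      lemma₁ = solve-∀
      lemma₂ : ∀ R e z S k → (R * S - R * e * z) + R * (e * z - S) ≡ k * 0ℤ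
      lemma₂ = solve-∀
      lemma₃ : ∀ k r x → k * (r * x) ≡ r * (k * x)
      lemma₃ = solve-∀
      scaled : + k * weight (x ∘ suc) ≡ weight (λ i → + D i * z (suc i) - z zero)
      scaled = trans (sym (∑-*ˡ (+ k) (λ i → + r i * x (suc i))))
        (∑-cong (λ i → trans (lemma₃ (+ k) (+ r i) (x (suc i)))
        (cong (+ r i *_) (trans (p (suc i)) (row-suc z i)))))

    lift : ℤ → (Fin n → ℤ) → Fin (suc n) → ℤ
    lift c y zero    = c
    lift c y (suc i) = y i

    lift-torsion : ∀ y q → weight y ≡ q * + R → Torsion M (lift (- q) y)
    lift-torsion y q w = image⇒torsion M R (positive zero) z λ
      { zero    → trans (lemma (+ R) (+ e) q) (sym (trans (row-zero z) (cong (_-_ (+ e * 0ℤ)) w)))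
      ; (suc i) → trans (trans (cong (_* y i) (sym (rD≡R i))) (lemma′ (+ r i) (+ D i) (y i)))
                    (sym (row-suc z i)) }
      where
      -- With 0 at the centre, the row of leaf i gives Dᵢ rᵢ yᵢ = R yᵢ, and the central row gives
      -- minus the weight of `y`.
      z = lift 0ℤ (λ i → + r i * y i)
      lemma : ∀ R e q → R * (- q) ≡ e * 0ℤ - q * R
      lemma = solve-∀
      lemma′ : ∀ r D y → r * D * y ≡ D * (r * y) - 0ℤ
      lemma′ = solve-∀

    private
      K = criticalGroup s
      module K = AbelianGroup K

    -- The map forgets the centre, which is recovered as minus the quotient of the weight by `R`.
    -- The central coordinate of a preimage `z` becomes the shift along (1, ..., 1).
    criticalGroup↔residues : Inverse K.setoid (DecSetoid.setoid decSetoid)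
    criticalGroup↔residues = strictInverse K.setoid (DecSetoid.setoid decSetoid)
      (λ { (x , t) → x ∘ suc , divides (- x zero) (torsion-weight {x} t) })
      from
      (λ { {x , _} {y , _} (z , p) → z zero , λ i → divides (z (suc i)) (trans
          (cong (_+ z zero) (trans (p (suc i)) (row-suc z i)))
          (lemma₁ (+ D i) (z (suc i)) (z zero))) })
      (λ {x} {y} → from-cong {x} {y})
      (λ { (y , _) → 0ℤ , congruent-reflexive {y} (λ _ → refl) })
      (λ { (x , t) → ≗⇒≈ M {lift (- - x zero) (x ∘ suc)} {x}
          λ { zero → neg-involutive (x zero) ; (suc _) → refl } })
      where
      lemma₁ : ∀ D z c → D * z - c + c ≡ z * D
      lemma₁ = solve-∀
      lemma₂ : ∀ x y c → x - y ≡ (x - y + c) - c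
      lemma₂ = solve-∀
      lemma₃ : ∀ q q′ ec → - q - - q′ ≡ ec - (q - q′ + ec)
      lemma₃ = solve-∀
      from : Carrier → K.Carrier
      from (y , divides q w) = lift (- q) y , lift-torsion y q w
      from-cong : ∀ {x y} → x ≈ y → from x K.≈ from y
      -- The preimage has the shift at the centre and the quotients of the congruences at the
      -- leaves; `sum-quotients` settles the central row.
      from-cong {x , divides q wx} {y , divides q′ wy} (c , p) = lift c z , λ
        { zero    → trans (lemma₃ q q′ (+ e * c)) (trans (cong (_-_ (+ e * c))
                    (sym (sum-quotients e ∑r≡R*e x y {q} {q′} c z wx wy (λ i → _∣_.equality (p i)))))
                      (sym (row-zero (lift c z))))
        ; (suc i) → trans (lemma₂ (x i) (y i) c) (trans
                    (cong (_- c) (trans (_∣_.equality (p i)) (*-comm (z i) (+ D i))))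
                    (sym (row-suc (lift c z) i))) }
        where z = λ i → _∣_.quotient (p i)

  -- The critical group of a complete graph.

  module CompleteGroup {m} (s : ArithmeticalStructure (complete (suc m))) where
    open ArithmeticalStructure s

    n : ℕ
    n = suc m

    -- Adding the identity to the adjacency matrix gives the all-ones matrix J, so diag(d) - A =
    -- diag(d + 1) - J, and balance reads rᵢ (dᵢ + 1) = Σ r.
    D : Fin n → ℕ
    D i = suc (d i)
    R : ℕ
    R = ∑ℕ.sum r

    0<R : 0 < R
    0<R = ℕ.<-≤-trans (positive zero) (ℕ.m≤m+n (r zero) _)

    adjacency-row : ∀ (z : Fin n → ℤ) i → ∑ (λ j → + completeAdj n i j * z j) ≡ ∑ z - z i
    adjacency-row z i = trans (cancel (∑ (λ j → + completeAdj n i j * z j)) (z i)) (cong (_- z i)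
      (trans (cong (_+_ (∑ (λ j → + completeAdj n i j * z j)))
        (trans (sym (*-identityˡ (z i))) (sym (∑-diag (const (+ 1)) z i))))
      (trans (sym (∑-+ (λ j → + completeAdj n i j * z j) (λ j → diag (const (+ 1)) i j * z j)))
        (∑-cong entry))))
      where
      cancel : ∀ x y → x ≡ x + y - y
      cancel = solve-∀
      entry : ∀ j → + completeAdj n i j * z j + diag (const (+ 1)) i j * z j ≡ z j
      entry j with i ≟ j
      ... | yes _ = lemma (z j)
        where
        lemma : ∀ z → + 0 * z + + 1 * z ≡ z
        lemma = solve-∀
      ... | no _  = lemma (z j)
        where
        lemma : ∀ z → + 1 * z + + 0 * z ≡ z
        lemma = solve-∀

    r*D≡R : ∀ i → r i ℕ.* D i ≡ R
    r*D≡R i = trans (ℕ.*-suc (r i) (d i)) (+-injective (begin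
      + (r i ℕ.+ r i ℕ.* d i)                                   ≡⟨ pos-+ (r i) _ ⟩
      + r i + + (r i ℕ.* d i)                                   ≡⟨ cong (λ w → + r i + + w) (balanced i) ⟩
      + r i + + ∑ℕ.sum (λ j → completeAdj n i j ℕ.* r j)
        ≡⟨ cong (_+_ (+ r i)) (pos-∑ (λ j → completeAdj n i j ℕ.* r j)) ⟩
      + r i + ∑ (λ j → + (completeAdj n i j ℕ.* r j))
        ≡⟨ cong (_+_ (+ r i)) (∑-cong (λ j → pos-* (completeAdj n i j) (r j))) ⟩
      + r i + ∑ (λ j → + completeAdj n i j * + r j)
        ≡⟨ cong (_+_ (+ r i)) (adjacency-row (λ j → + r j) i) ⟩
      + r i + (∑ (λ j → + r j) - + r i)                         ≡⟨ lemma (+ r i) _ ⟩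
      ∑ (λ j → + r j)                                           ≡⟨ pos-∑ r ⟨
      + R                                                       ∎))
      where
      open ≡-Reasoning
      lemma : ∀ x y → x + (y - x) ≡ y
      lemma = solve-∀

    R∣∑r : R ℕ.∣ ∑ℕ.sum r
    R∣∑r = ℕ.∣-refl

    open Residues D r R 0<R r*D≡R R∣∑r

    M : Matrix n
    M u v = diag (λ w → + d w) u v - + completeAdj n u v

    row : ∀ z i → (M *ᵥ z) i ≡ + D i * z i - ∑ z
    row z i = begin
      ∑ (λ j → (diag (λ w → + d w) i j - + completeAdj n i j) * z j)
        ≡⟨ ∑-cong (λ j → lemma₁ (diag (λ w → + d w) i j) (+ completeAdj n i j) (z j)) ⟩
      ∑ (λ j → diag (λ w → + d w) i j * z j + - (+ completeAdj n i j * z j))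
        ≡⟨ ∑-+ (λ j → diag (λ w → + d w) i j * z j) (λ j → - (+ completeAdj n i j * z j)) ⟩
      ∑ (λ j → diag (λ w → + d w) i j * z j) + ∑ (λ j → - (+ completeAdj n i j * z j))
        ≡⟨ cong₂ _+_ (∑-diag (λ w → + d w) z i)
            (trans (∑-neg (λ j → + completeAdj n i j * z j)) (cong -_ (adjacency-row z i))) ⟩
      + d i * z i + - (∑ z - z i)
        ≡⟨ lemma₂ (+ d i) (z i) (∑ z) ⟩
      + D i * z i - ∑ z ∎
      where
      open ≡-Reasoning
      lemma₁ : ∀ x a z → (x - a) * z ≡ x * z + - (a * z)
      lemma₁ = solve-∀
      lemma₂ : ∀ d z S → d * z + - (S - z) ≡ (+ 1 + d) * z - S
      lemma₂ = solve-∀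

    ∑r≡R*1 : ∑ℕ.sum r ≡ R ℕ.* 1
    ∑r≡R*1 = sym (ℕ.*-identityʳ R)

    -- As for the star, `r` is orthogonal to the image: the two terms of `row` both contribute R · Σ
    -- z.
    torsion-weight : ∀ {x} → Torsion M x → weight x ≡ 0ℤ
    torsion-weight {x} t = weight≡0 (torsion⇒image M {x} t)
      where
      open ≡-Reasoning
      lemma₁ : ∀ k r x → k * (r * x) ≡ r * (k * x)
      lemma₁ = solve-∀
      lemma₂ : ∀ R S k → R * S - R * S ≡ k * 0ℤ
      lemma₂ = solve-∀
      weight≡0 : (∃ λ k → NonZero k × ∃ λ z → ∀ v → + k * x v ≡ (M *ᵥ z) v) → weight x ≡ 0ℤ
      weight≡0 (k , k≢0 , z , p) = *-cancelˡ-≡ (+ k) _ _ {{k≢0}} (begin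
        + k * weight x                     ≡⟨ ∑-*ˡ (+ k) (λ i → + r i * x i) ⟨
        ∑ (λ i → + k * (+ r i * x i))
          ≡⟨ ∑-cong (λ i → trans (lemma₁ (+ k) (+ r i) (x i)) (cong (+ r i *_) (trans (p i) (row z i)))) ⟩
        weight (λ i → + D i * z i - ∑ z)   ≡⟨ weight-D*- z (∑ z) ⟩
        + R * ∑ z - + R * ∑ z              ≡⟨ lemma₂ (+ R) (∑ z) (+ k) ⟩
        + k * 0ℤ                           ∎)

    shift : ℤ → (Fin n → ℤ) → Fin n → ℤ
    shift q y i = y i - q

    -- Since Σ r = R, subtracting `q` everywhere brings the weight to 0. Then `R` times the vector
    -- is the image of the rᵢ yᵢ, whose sum is the weight of `y`.
    shift-torsion : ∀ y q → weight y ≡ q * + R → Torsion M (shift q y)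
    shift-torsion y q w = image⇒torsion M R 0<R z λ i → begin
      + R * (y i - q)                     ≡⟨ lemma₁ (+ R) (y i) q ⟩
      + R * y i - q * + R                 ≡⟨ cong (λ ρ → ρ * y i - q * + R) (rD≡R i) ⟨
      + r i * + D i * y i - q * + R       ≡⟨ cong₂ _-_ (lemma₂ (+ r i) (+ D i) (y i)) (sym w) ⟩
      + D i * z i - ∑ z                   ≡⟨ row z i ⟨
      (M *ᵥ z) i                          ∎
      where
      open ≡-Reasoning
      z : Fin n → ℤ
      z i = + r i * y i
      lemma₁ : ∀ R y q → R * (y - q) ≡ R * y - q * R
      lemma₁ = solve-∀
      lemma₂ : ∀ r D y → r * D * y ≡ D * (r * y)
      lemma₂ = solve-∀

    private
      K = criticalGroup s
      module K = AbelianGroup K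

    criticalGroup↔residues : Inverse K.setoid (DecSetoid.setoid decSetoid)
    criticalGroup↔residues = strictInverse K.setoid (DecSetoid.setoid decSetoid)
      (λ { (x , t) → x , divides 0ℤ (torsion-weight {x} t) })
      from
      (λ { {x , _} {y , _} (z , p) → ∑ z , λ i → divides (z i) (trans
          (cong (_+ ∑ z) (trans (p i) (row z i))) (lemma₁ (+ D i) (z i) (∑ z))) })
      (λ {x} {y} → from-cong {x} {y})
      (λ { (y , divides q _) → q , λ i → divides 0ℤ (lemma₂ (y i) q) })
      (λ { (x , t) → ≗⇒≈ M {shift 0ℤ x} {x} λ v → +-identityʳ (x v) })
      where
      lemma₁ : ∀ D z c → D * z - c + c ≡ z * D
      lemma₁ = solve-∀
      lemma₂ : ∀ y q → y - q - y + q ≡ 0ℤ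
      lemma₂ = solve-∀
      lemma₃ : ∀ x y q q′ c → (x - q) - (y - q′) ≡ (x - y + c) - (q - q′ + + 1 * c)
      lemma₃ = solve-∀
      from : Carrier → K.Carrier
      from (y , divides q w) = shift q y , shift-torsion y q w
      from-cong : ∀ {x y} → x ≈ y → from x K.≈ from y
      from-cong {x , divides q wx} {y , divides q′ wy} (c , p) = z , λ i →
        trans (lemma₃ (x i) (y i) q q′ c) (trans (cong₂ _-_
          (trans (_∣_.equality (p i)) (*-comm (z i) (+ D i)))
          (sym (sum-quotients 1 ∑r≡R*1 x y {q} {q′} c z wx wy (λ i → _∣_.equality (p i)))))
        (sym (row z i)))
        where z = λ i → _∣_.quotient (p i)

open CriticalGroups using (module Residues; module StarGroup; module CompleteGroup)
import Algebra.Properties.CommutativeSemigroup as CommutativeSemigroup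
open import Data.List.Relation.Binary.Permutation.Propositional using (↭-sym)
open import Data.List.Relation.Binary.Permutation.Propositional.Properties using (∈-resp-↭; map⁺; ↭-length)
open import Data.List.Relation.Unary.Linked using (Linked; _∷_)
import Data.List.Sort as Sort
open import Data.Nat.Base
open import Data.Nat.DivMod using (m/n*n≡m)
open import Data.Nat.Divisibility
open import Data.Nat.Induction using (<-rec)
open import Data.Nat.ListAction.Properties using (sum-↭)
open import Data.Nat.Properties
open import Data.Nat.Tactic.RingSolver using (solve-∀)
import Function.Construct.Composition as Composition
import Relation.Binary.Construct.On as On
open CommutativeSemigroup *-commutativeSemigroup using () renaming (interchange to *-interchange)

-- Sums and products over intervals, given by start and length.

foldFrom : (ℕ → ℕ → ℕ) → ℕ → (ℕ → ℕ) → ℕ → ℕ → ℕ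
foldFrom _∙_ ε f j zero    = ε
foldFrom _∙_ ε f j (suc l) = f j ∙ foldFrom _∙_ ε f (suc j) l

sumFrom productFrom : (ℕ → ℕ) → ℕ → ℕ → ℕ
sumFrom     = foldFrom _+_ 0
productFrom = foldFrom _*_ 1

sumFrom-split : ∀ f j l m → sumFrom f j (l + m) ≡ sumFrom f j l + sumFrom f (j + l) m
sumFrom-split f j zero    m = cong (λ i → sumFrom f i m) (sym (+-identityʳ j))
sumFrom-split f j (suc l) m = begin
  f j + sumFrom f (suc j) (l + m)                          ≡⟨ cong (f j +_) (sumFrom-split f (suc j) l m) ⟩
  f j + (sumFrom f (suc j) l + sumFrom f (suc (j + l)) m)  ≡⟨ +-assoc (f j) _ _ ⟨
  f j + sumFrom f (suc j) l + sumFrom f (suc (j + l)) m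
    ≡⟨ cong (λ i → f j + sumFrom f (suc j) l + sumFrom f i m) (+-suc j l) ⟨
  f j + sumFrom f (suc j) l + sumFrom f (j + suc l) m      ∎
  where open ≡-Reasoning

sumFrom-*ˡ : ∀ c f j l → sumFrom (λ i → c * f i) j l ≡ c * sumFrom f j l
sumFrom-*ˡ c f j zero    = sym (*-zeroʳ c)
sumFrom-*ˡ c f j (suc l) = trans (cong (c * f j +_) (sumFrom-*ˡ c f (suc j) l))
  (sym (*-distribˡ-+ c (f j) _))

sumFrom-const : ∀ {f c} → (∀ i → f i ≡ c) → ∀ j l → sumFrom f j l ≡ l * c
sumFrom-const p j zero    = refl
sumFrom-const p j (suc l) = cong₂ _+_ (p j) (sumFrom-const p (suc j) l)

sumFrom-cong : ∀ {f g} → (∀ i → f i ≡ g i) → ∀ j l → sumFrom f j l ≡ sumFrom g j l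
sumFrom-cong p j zero    = refl
sumFrom-cong p j (suc l) = cong₂ _+_ (p j) (sumFrom-cong p (suc j) l)

productFrom-* : ∀ f g j l →
  productFrom (λ i → f i * g i) j l ≡ productFrom f j l * productFrom g j l
productFrom-* f g j zero    = refl
productFrom-* f g j (suc l) = trans (cong (f j * g j *_) (productFrom-* f g (suc j) l))
  (*-interchange (f j) (g j) _ _)

^-distribʳ-* : ∀ k x y → (x * y) ^ k ≡ x ^ k * y ^ k
^-distribʳ-* zero    x y = refl
^-distribʳ-* (suc k) x y = trans (cong (x * y *_) (^-distribʳ-* k x y)) (*-interchange x y (x ^ k) (y ^ k))

-- Inequalities: Young, AM-GM, Abel summation.

rearrangement : ∀ {x y p q} → x ≤ y → p ≤ q → p * y + q * x ≤ p * x + q * y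
rearrangement {x} {y} {p} {q} x≤y p≤q
  with m≤n⇒∃[o]m+o≡n x≤y | m≤n⇒∃[o]m+o≡n p≤q
... | u , refl | v , refl = subst (p * (x + u) + (p + v) * x ≤_) (expand x u p v) (m≤m+n _ (v * u))
  where
  expand : ∀ x u p v → p * (x + u) + (p + v) * x + v * u ≡ p * x + (p + v) * (x + u)
  expand = solve-∀

-- AM-GM for k copies of one number and a single other one. The induction multiplies by `x` and then
-- applies the rearrangement inequality to x, y and their powers of exponent k + 1.
young : ∀ k x y → suc k * (x ^ k * y) ≤ y ^ suc k + k * x ^ suc k
young zero    x y = ≤-reflexive (lemma y)
  where
  lemma : ∀ y → 1 * (1 * y) ≡ y * 1 + 0
  lemma = solve-∀
young (suc k) x y = begin
  suc (suc k) * (x * X * y)              ≡⟨ lemma₁ k x X y ⟩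
  x * (suc k * (X * y)) + x * X * y      ≤⟨ +-monoˡ-≤ (x * X * y) (*-monoʳ-≤ x (young k x y)) ⟩
  x * (y * Y + k * (x * X)) + x * X * y  ≡⟨ lemma₂ k x X y Y ⟩
  (x * X * y + y * Y * x) + k * (x * (x * X))
    ≤⟨ +-monoˡ-≤ (k * (x * (x * X))) swap ⟩
  (x * X * x + y * Y * y) + k * (x * (x * X)) ≡⟨ lemma₃ k x X y Y ⟩
  y * (y * Y) + suc k * (x * (x * X))    ∎
  where
  open ≤-Reasoning
  X = x ^ k
  Y = y ^ k

  lemma₁ : ∀ k x X y → suc (suc k) * (x * X * y) ≡ x * (suc k * (X * y)) + x * X * y
  lemma₁ = solve-∀
  lemma₂ : ∀ k x X y Y → x * (y * Y + k * (x * X)) + x * X * y ≡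
           (x * X * y + y * Y * x) + k * (x * (x * X))
  lemma₂ = solve-∀
  lemma₃ : ∀ k x X y Y → (x * X * x + y * Y * y) + k * (x * (x * X)) ≡
           y * (y * Y) + suc k * (x * (x * X))
  lemma₃ = solve-∀

  swap : x * X * y + y * Y * x ≤ x * X * x + y * Y * y
  swap with ≤-total x y
  ... | inj₁ x≤y = rearrangement x≤y (^-monoˡ-≤ (suc k) x≤y)
  ... | inj₂ y≤x = subst₂ _≤_ (+-comm (y * Y * x) _) (+-comm (y * Y * y) _)
                     (rearrangement y≤x (^-monoˡ-≤ (suc k) y≤x))

-- Young's inequality at X = (l + 1) S and Y = l (S + t).
am-gm-step : ∀ l S t .{{_ : NonZero l}} →
  suc l ^ suc l * (S ^ l * t) ≤ l ^ l * (t + S) ^ suc l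
am-gm-step l S t = *-cancelˡ-≤ l (+-cancelʳ-≤ (l * X ^ suc l) _ _ (begin
  l * (suc l ^ suc l * (S ^ l * t)) + l * X ^ suc l
    ≡⟨ cong (_+ l * X ^ suc l) (lemma₁ l (suc l ^ l) (S ^ l) t) ⟩
  suc l * ((suc l ^ l * S ^ l) * (l * t)) + l * X ^ suc l
    ≡⟨ cong (λ e → suc l * (e * (l * t)) + l * X ^ suc l) (^-distribʳ-* l (suc l) S) ⟨
  suc l * (X ^ l * (l * t)) + l * (suc l * S * X ^ l)
    ≡⟨ lemma₂ l S t (X ^ l) ⟩
  suc l * (X ^ l * Y)                 ≤⟨ young l X Y ⟩
  Y ^ suc l + l * X ^ suc l
    ≡⟨ cong (_+ l * X ^ suc l) (^-distribʳ-* (suc l) l (t + S)) ⟩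
  l ^ suc l * (t + S) ^ suc l + l * X ^ suc l
    ≡⟨ cong (_+ l * X ^ suc l) (*-assoc l (l ^ l) _) ⟩
  l * (l ^ l * (t + S) ^ suc l) + l * X ^ suc l ∎))
  where
  open ≤-Reasoning
  X = suc l * S
  Y = l * (t + S)
  lemma₁ : ∀ l L Sˡ t → l * (suc l * L * (Sˡ * t)) ≡ suc l * ((L * Sˡ) * (l * t))
  lemma₁ = solve-∀
  lemma₂ : ∀ l S t Xˡ → suc l * (Xˡ * (l * t)) + l * (suc l * S * Xˡ) ≡ suc l * (Xˡ * (l * (t + S)))
  lemma₂ = solve-∀

-- Induction, adjoining `f j` to a block with sum `S`. A single term is a case of its own because
-- `am-gm-step` divides by `l`.
am-gm : ∀ f j l → l ^ l * productFrom f j l ≤ sumFrom f j l ^ l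
am-gm f j zero          = ≤-refl
am-gm f j (suc zero)    = ≤-reflexive (lemma (f j))
  where
  lemma : ∀ t → 1 * 1 * (t * 1) ≡ (t + 0) * 1
  lemma = solve-∀
am-gm f j (suc l@(suc _)) = *-cancelˡ-≤ (l ^ l) {{m^n≢0 l l}} (begin
  l ^ l * (suc l ^ suc l * (f j * P))    ≡⟨ lemma (l ^ l) (suc l ^ suc l) (f j) P ⟩
  suc l ^ suc l * (l ^ l * P * f j)
    ≤⟨ *-monoʳ-≤ (suc l ^ suc l) (*-monoˡ-≤ (f j) (am-gm f (suc j) l)) ⟩
  suc l ^ suc l * (S ^ l * f j)          ≤⟨ am-gm-step l S (f j) ⟩
  l ^ l * (f j + S) ^ suc l              ∎)
  where
  open ≤-Reasoning
  P = productFrom f (suc j) l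
  S = sumFrom f (suc j) l
  lemma : ∀ w x y z → w * (x * (y * z)) ≡ x * (w * z * y)
  lemma = solve-∀

-- Abel summation: lowering all weights by a common c ≤ d j only uses that
-- the total of g is at most the total of f.
abel : ∀ (d f g : ℕ → ℕ) → (∀ i → d i ≤ d (suc i)) → ∀ c j l → c ≤ d j →
  (∀ i m → i + m ≡ j + l → sumFrom g i m ≤ sumFrom f i m) →
  sumFrom (λ i → d i * g i) j l + c * sumFrom f j l ≤
  sumFrom (λ i → d i * f i) j l + c * sumFrom g j l
abel d f g mono c j zero    c≤d tails = ≤-refl
abel d f g mono c j (suc l) c≤d tails with m≤n⇒∃[o]m+o≡n c≤d
-- The recursive call lowers the later weights by `d j`. What remains is a common weight e = d j - c
-- on the whole interval, where the totals are compared.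
... | e , c+e≡d = +-cancelʳ-≤ (d j * F) _ _ (begin
  d j * g j + dG + c * (f j + F) + d j * F   ≡⟨ lemma₁ (d j) (g j) dG c (f j) F ⟩
  d j * g j + c * (f j + F) + (dG + d j * F)
    ≤⟨ +-monoʳ-≤ (d j * g j + c * (f j + F)) (abel d f g mono (d j) (suc j) l (mono j)
         λ i m p → tails i m (trans p (sym (+-suc j l)))) ⟩
  d j * g j + c * (f j + F) + (dF + d j * G) ≡⟨ cong (λ x → x * g j + c * (f j + F) + (dF + x * G)) c+e≡d ⟨
  (c + e) * g j + c * (f j + F) + (dF + (c + e) * G) ≡⟨ lemma₂ c e (g j) (f j) F dF G ⟩
  c * (g j + G) + e * (g j + G) + (c * (f j + F) + dF)
    ≤⟨ +-monoˡ-≤ (c * (f j + F) + dF) (+-monoʳ-≤ (c * (g j + G)) (*-monoʳ-≤ e (tails j (suc l) refl))) ⟩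
  c * (g j + G) + e * (f j + F) + (c * (f j + F) + dF) ≡⟨ lemma₃ c e (g j) (f j) F dF G ⟩
  (c + e) * f j + dF + c * (g j + G) + (c + e) * F ≡⟨ cong (λ x → x * f j + dF + c * (g j + G) + x * F) c+e≡d ⟩
  d j * f j + dF + c * (g j + G) + d j * F ∎)
  where
  open ≤-Reasoning
  F  = sumFrom f (suc j) l
  G  = sumFrom g (suc j) l
  dF = sumFrom (λ i → d i * f i) (suc j) l
  dG = sumFrom (λ i → d i * g i) (suc j) l
  lemma₁ : ∀ d g dG c f F → d * g + dG + c * (f + F) + d * F ≡ d * g + c * (f + F) + (dG + d * F)
  lemma₁ = solve-∀
  lemma₂ : ∀ c e g f F dF G → (c + e) * g + c * (f + F) + (dF + (c + e) * G) ≡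
           c * (g + G) + e * (g + G) + (c * (f + F) + dF)
  lemma₂ = solve-∀
  lemma₃ : ∀ c e g f F dF G → c * (g + G) + e * (f + F) + (c * (f + F) + dF) ≡
           (c + e) * f + dF + c * (g + G) + (c + e) * F
  lemma₃ = solve-∀

-- The reference sequence: 1 / b j = Σ_{j ≤ i < k} 1 / (b i + 1) + 1 / b k.
b : ℕ → ℕ
b k = a (suc k)

b-suc : ∀ k → b (suc k) ≡ b k * suc (b k)
b-suc k = lemma (b k)
  where
  lemma : ∀ x → x * (x * 1) + x ≡ x * suc x
  lemma = solve-∀

0<b : ∀ k → 0 < b k
0<b zero    = s≤s z≤n
0<b (suc k) = <-≤-trans (0<b k) (m≤n+m (b k) (b k ^ 2))

-- Telescoping: the factor `suc (b i)` turns `b i` into `b (suc i)`.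
b-product : ∀ j l → b j * productFrom (λ i → suc (b i)) j l ≡ b (j + l)
b-product j zero    = trans (*-identityʳ (b j)) (cong b (sym (+-identityʳ j)))
b-product j (suc l) = begin
  b j * (suc (b j) * P)  ≡⟨ *-assoc (b j) _ _ ⟨
  b j * suc (b j) * P    ≡⟨ cong (_* P) (b-suc j) ⟨
  b (suc j) * P          ≡⟨ b-product (suc j) l ⟩
  b (suc j + l)          ≡⟨ cong b (+-suc j l) ⟨
  b (j + suc l)          ∎
  where
  open ≡-Reasoning
  P = productFrom (λ i → suc (b i)) (suc j) l

suc-b∣b : ∀ i m → suc (b i) ∣ b (i + suc m)
suc-b∣b i m = subst (suc (b i) ∣_) (b-product i (suc m))
  (∣n⇒∣m*n (b i) (m∣m*n (productFrom (λ i → suc (b i)) (suc i) m)))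

-- The numerator of 1 / (b i + 1) over the common denominator `b k`; the division is exact for i < k
-- by `suc-b∣b`.
b-cofactor : ℕ → ℕ → ℕ
b-cofactor k i = b k / suc (b i)

b-cofactor-* : ∀ {k} i m → i + suc m ≡ k → b-cofactor k i * suc (b i) ≡ b k
b-cofactor-* i m refl = m/n*n≡m (suc-b∣b i m)

-- The identity 1 / b j = Σ 1 / (b i + 1) + 1 / b k, cleared of denominators. It iterates 1 / b j =
-- 1 / (b j + 1) + 1 / b (j + 1).
b-cofactor-sum : ∀ {k} j l → j + l ≡ k → b j * suc (sumFrom (b-cofactor k) j l) ≡ b k
b-cofactor-sum j zero    refl = trans (*-identityʳ (b j)) (cong b (sym (+-identityʳ j)))
b-cofactor-sum {k} j (suc l) eq = begin
  b j * suc (q + S)          ≡⟨ cong (λ x → b j * suc (x + S)) q≡ ⟩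
  b j * suc (b j * suc S + S) ≡⟨ lemma (b j) S ⟩
  b j * suc (b j) * suc S    ≡⟨ eq′ ⟩
  b k                        ∎
  where
  open ≡-Reasoning
  q = b-cofactor k j
  S = sumFrom (b-cofactor k) (suc j) l
  eq′ : b j * suc (b j) * suc S ≡ b k
  eq′ = trans (cong (_* suc S) (sym (b-suc j))) (b-cofactor-sum (suc j) l (trans (sym (+-suc j l)) eq))
  lemma : ∀ x S → x * suc (x * suc S + S) ≡ x * suc x * suc S
  lemma = solve-∀
  comm : ∀ x S → x * suc x * suc S ≡ x * suc S * suc x
  comm = solve-∀
  q≡ : q ≡ b j * suc S
  q≡ = *-cancelʳ-≡ q _ (suc (b j))
    (trans (b-cofactor-* j l eq) (trans (sym eq′) (comm (b j) S)))

b-cofactor-product : ∀ {k} j l → j + l ≡ k →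
  productFrom (b-cofactor k) j l * productFrom (λ i → suc (b i)) j l ≡ b k ^ l
b-cofactor-product j zero    eq = refl
b-cofactor-product {k} j (suc l) eq = trans
  (*-interchange (b-cofactor k j) _ (suc (b j)) _)
  (cong₂ _*_ (b-cofactor-* j l eq) (b-cofactor-product (suc j) l (trans (sym (+-suc j l)) eq)))

-- Curtiss's theorem for Egyptian fractions.

module EgyptianFractions
  (n R : ℕ) (d r : ℕ → ℕ) (0<R : 0 < R)
  (r*d≡R : ∀ i → r i * d i ≡ R) (d-mono : ∀ i → d i ≤ d (suc i))
  (R∣∑r : R ∣ sumFrom r 0 n)
  where

  private instance
    R≢0 : NonZero R
    R≢0 = >-nonZero 0<R

  -- R times the remainder Σ 1 / dᵢ over k ≤ i < n.
  tail : ℕ → ℕ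
  tail k = sumFrom r k (n ∸ k)

  tail-split : ∀ j l {k} → j + l ≡ k → k ≤ n → tail j ≡ sumFrom r j l + tail k
  tail-split j l refl j+l≤n = trans (cong (sumFrom r j) eq) (sumFrom-split r j l (n ∸ (j + l)))
    where
    eq : n ∸ j ≡ l + (n ∸ (j + l))
    eq = sym (trans (cong (l +_) (sym (∸-+-assoc n j l)))
      (m+[n∸m]≡n (m+n≤o⇒m≤o∸n l (≤-trans (≤-reflexive (+-comm l j)) j+l≤n))))

  0<r*d : ∀ i → 0 < r i * d i
  0<r*d i = subst (0 <_) (sym (r*d≡R i)) 0<R

  0<d : ∀ i → 0 < d i
  0<d i = n≢0⇒n>0 λ d≡0 → <-irrefl (sym (trans (cong (r i *_) d≡0) (*-zeroʳ (r i)))) (0<r*d i)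

  0<r : ∀ i → 0 < r i
  0<r i = n≢0⇒n>0 λ r≡0 → <-irrefl (sym (cong (_* d i) r≡0)) (0<r*d i)

  0<tail : ∀ {k} → k < n → 0 < tail k
  0<tail {k} k<n with n ∸ k | m<n⇒0<n∸m k<n
  ... | suc l | _ = <-≤-trans (0<r k) (m≤m+n (r k) _)

  0<productFrom-d : ∀ j l → 0 < productFrom d j l
  0<productFrom-d j zero    = s≤s z≤n
  0<productFrom-d j (suc l) = *-mono-< (0<d j) (0<productFrom-d (suc j) l)

  -- The product of the `d i` is a common denominator: each `r i` times it contains the factor
  -- `r i * d i`, which is `R`.
  R∣sum*product : ∀ j l → R ∣ sumFrom r j l * productFrom d j l
  R∣sum*product j zero    = R ∣0
  R∣sum*product j (suc l) = subst (R ∣_) (sym (lemma (r j) (d j) _ _))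
    (∣m∣n⇒∣m+n (∣m⇒∣m*n _ (∣-reflexive (sym (r*d≡R j)))) (∣n⇒∣m*n (d j) (R∣sum*product (suc j) l)))
    where
    lemma : ∀ r d S P → (r + S) * (d * P) ≡ r * d * P + d * (S * P)
    lemma = solve-∀

  -- The remainder tail k / R is a positive fraction with denominator
  -- dividing d 0 ⋯ d (k - 1).
  R≤tail*product : ∀ {k} → k < n → R ≤ tail k * productFrom d 0 k
  R≤tail*product {k} k<n = ∣⇒≤ {{>-nonZero (*-mono-< (0<tail k<n) (0<productFrom-d 0 k))}}
    -- `R` divides the full sum times the product and the initial sum times the product, hence also
    -- their difference.
    (∣m+n∣m⇒∣n
      (subst (R ∣_) (trans (cong (_* P) (tail-split 0 k refl (<⇒≤ k<n)))
          (*-distribʳ-+ P (sumFrom r 0 k) (tail k)))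
        (∣m⇒∣m*n P R∣∑r))
      (R∣sum*product 0 k))
    where P = productFrom d 0 k

  -- The remainder is at least 1 / b k. Positions count from 0, matching the shift in
  -- `b k = a (suc k)`.
  RemainderBound : ℕ → Set
  RemainderBound k = k < n → R ≤ b k * tail k

  module _ {k} (k<n : k < n) (earlier : ∀ {j} → j < k → RemainderBound j)
    (small : b k * tail k ≤ R) where

    private
      q = b-cofactor k

    -- The remainder at j is at least 1 / b j = Σ 1 / (b i + 1) + 1 / b k, and the one at k is at
    -- most 1 / b k; subtract.
    tails-dominate : ∀ j l → j + l ≡ k → R * sumFrom q j l ≤ b k * sumFrom r j l
    tails-dominate j zero    eq = ≤-trans (≤-reflexive (*-zeroʳ R)) z≤n
    tails-dominate j l@(suc l′) eq = +-cancelʳ-≤ R _ _ (begin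
      R * S + R                          ≡⟨ lemma₁ R S ⟩
      R * suc S                          ≤⟨ *-monoˡ-≤ (suc S) (earlier j<k (<-trans j<k k<n)) ⟩
      b j * tail j * suc S               ≡⟨ lemma₂ (b j) (tail j) (suc S) ⟩
      b j * suc S * tail j               ≡⟨ cong₂ _*_ (b-cofactor-sum j l eq) (tail-split j l eq (<⇒≤ k<n)) ⟩
      b k * (sumFrom r j l + tail k)     ≡⟨ *-distribˡ-+ (b k) _ _ ⟩
      b k * sumFrom r j l + b k * tail k ≤⟨ +-monoʳ-≤ (b k * sumFrom r j l) small ⟩
      b k * sumFrom r j l + R            ∎)
      where
      open ≤-Reasoning
      S = sumFrom q j l
      j<k : j < k
      j<k = subst (j <_) eq (m<m+n j (s≤s z≤n))
      lemma₁ : ∀ R S → R * S + R ≡ R * suc S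
      lemma₁ = solve-∀
      lemma₂ : ∀ x y z → x * y * z ≡ x * z * y
      lemma₂ = solve-∀

    -- After division by `b k` this is Σ dᵢ / (bᵢ + 1) ≤ k. By Abel summation 1 / (bᵢ + 1) may be
    -- replaced by 1 / dᵢ, and then each term is 1.
    weighted-sum≤ : sumFrom (λ i → d i * q i) 0 k ≤ k * b k
    weighted-sum≤ = *-cancelˡ-≤ R (begin
      R * sumFrom (λ i → d i * q i) 0 k      ≡⟨ sumFrom-*ˡ R (λ i → d i * q i) 0 k ⟨
      sumFrom (λ i → R * (d i * q i)) 0 k    ≡⟨ sumFrom-cong (λ i → lemma₁ R (d i) (q i)) 0 k ⟩
      sumFrom (λ i → d i * (R * q i)) 0 k
        -- At c = 0 the correction terms of `abel` reduce to 0.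
        ≤⟨ +-cancelʳ-≤ 0 _ _ (abel d (λ i → b k * r i) (λ i → R * q i) d-mono 0 0 k z≤n
             λ i m eq → subst₂ _≤_ (sym (sumFrom-*ˡ R q i m)) (sym (sumFrom-*ˡ (b k) r i m))
               (tails-dominate i m eq)) ⟩
      sumFrom (λ i → d i * (b k * r i)) 0 k
        ≡⟨ sumFrom-const (λ i → trans (lemma₂ (d i) (b k) (r i)) (cong (b k *_) (r*d≡R i))) 0 k ⟩
      k * (b k * R)                          ≡⟨ lemma₃ k (b k) R ⟩
      R * (k * b k)                          ∎)
      where
      open ≤-Reasoning
      lemma₁ : ∀ x y z → x * (y * z) ≡ y * (x * z)
      lemma₁ = solve-∀
      lemma₂ : ∀ d b r → d * (b * r) ≡ b * (r * d)
      lemma₂ = solve-∀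
      lemma₃ : ∀ x y z → x * (y * z) ≡ z * (x * y)
      lemma₃ = solve-∀

    -- By AM-GM the numbers `d i * q i` have product at most `b k ^ k`, which is `Q * b k`; cancel
    -- `Q`.
    product≤ : .{{_ : NonZero k}} → productFrom d 0 k ≤ b k
    product≤ = *-cancelʳ-≤ (productFrom d 0 k) (b k) Q {{m*n≢0⇒m≢0 Q {{Qs≢0}}}}
      (*-cancelˡ-≤ (k ^ k) {{m^n≢0 k k}} (begin
      k ^ k * (productFrom d 0 k * Q)             ≡⟨ cong (k ^ k *_) (productFrom-* d q 0 k) ⟨
      k ^ k * productFrom (λ i → d i * q i) 0 k   ≤⟨ am-gm (λ i → d i * q i) 0 k ⟩
      sumFrom (λ i → d i * q i) 0 k ^ k           ≤⟨ ^-monoˡ-≤ k weighted-sum≤ ⟩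
      (k * b k) ^ k                               ≡⟨ ^-distribʳ-* k k (b k) ⟩
      k ^ k * b k ^ k                             ≡⟨ cong (k ^ k *_) (b-cofactor-product 0 k refl) ⟨
      k ^ k * (Q * s)                             ≡⟨ cong (k ^ k *_) (trans (*-comm Q s) (cong (_* Q) s≡b)) ⟩
      k ^ k * (b k * Q)                           ∎))
      where
      open ≤-Reasoning
      Q = productFrom q 0 k
      s = productFrom (λ i → suc (b i)) 0 k
      s≡b : s ≡ b k
      s≡b = trans (sym (*-identityˡ s)) (b-product 0 k)
      Qs≢0 : NonZero (Q * s)
      Qs≢0 = subst NonZero (sym (b-cofactor-product 0 k refl)) (m^n≢0 (b k) k {{>-nonZero (0<b k)}})

  -- Strong induction. If the remainder is at most 1 / b k, the product of the earlier `d i` is at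
  -- most `b k`, and the remainder is at least the reciprocal of that product. For k = 0 the product
  -- is empty and `b 0` is 1.
  remainder-bound : ∀ k → RemainderBound k
  remainder-bound = <-rec RemainderBound step
    where
    product-bound : ∀ {k} → k < n → (∀ {j} → j < k → RemainderBound j) → b k * tail k ≤ R →
                    productFrom d 0 k ≤ b k
    product-bound {zero}  k<n earlier small = ≤-refl
    product-bound {suc _} k<n earlier small = product≤ k<n earlier small

    step : ∀ k → (∀ {j} → j < k → RemainderBound j) → RemainderBound k
    step k earlier k<n with ≤-total R (b k * tail k)
    ... | inj₁ R≤bT = R≤bT
    ... | inj₂ bT≤R = begin
      R                          ≤⟨ R≤tail*product k<n ⟩
      tail k * productFrom d 0 k ≤⟨ *-monoʳ-≤ (tail k) (product-bound k<n earlier bT≤R) ⟩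
      tail k * b k               ≡⟨ *-comm (tail k) (b k) ⟩
      b k * tail k               ∎
      where open ≤-Reasoning

  r-anti : ∀ i → r (suc i) ≤ r i
  r-anti i = *-cancelʳ-≤ (r (suc i)) (r i) (d i) {{>-nonZero (0<d i)}} (begin
    r (suc i) * d i        ≤⟨ *-monoʳ-≤ (r (suc i)) (d-mono i) ⟩
    r (suc i) * d (suc i)  ≡⟨ r*d≡R (suc i) ⟩
    R                      ≡⟨ r*d≡R i ⟨
    r i * d i              ∎)
    where open ≤-Reasoning

  sumFrom-r≤ : ∀ k l c → r k ≤ c → sumFrom r k l ≤ l * c
  sumFrom-r≤ k zero    c _    = z≤n
  sumFrom-r≤ k (suc l) c rk≤c = +-mono-≤ rk≤c (sumFrom-r≤ (suc k) l c (≤-trans (r-anti k) rk≤c))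

  -- The remainder has n - k terms, none larger than 1 / d k, and is at least 1 / b k.
  d≤ : ∀ k → k < n → d k ≤ (n ∸ k) * b k
  d≤ k k<n = *-cancelˡ-≤ (r k) {{>-nonZero (0<r k)}} (begin
    r k * d k              ≡⟨ r*d≡R k ⟩
    R                      ≤⟨ remainder-bound k k<n ⟩
    b k * tail k           ≤⟨ *-monoʳ-≤ (b k) (sumFrom-r≤ k (n ∸ k) (r k) ≤-refl) ⟩
    b k * ((n ∸ k) * r k)  ≡⟨ lemma (b k) (n ∸ k) (r k) ⟩
    r k * ((n ∸ k) * b k)  ∎)
    where
    open ≤-Reasoning
    lemma : ∀ x y z → x * (y * z) ≡ z * (y * x)
    lemma = solve-∀

  -- The factors n - i from `d≤` run from 2 + l down to 3, so their product is half of the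
  -- factorial.
  product-d≤ : ∀ j l → j + (2 + l) ≡ n → 2 * productFrom d j l ≤ (2 + l) ! * productFrom b j l
  product-d≤ j zero    eq = ≤-refl
  product-d≤ j (suc l) eq = begin
    2 * (d j * productFrom d (suc j) l)   ≡⟨ lemma (d j) _ ⟩
    d j * (2 * productFrom d (suc j) l)
      ≤⟨ *-mono-≤ (d≤ j j<n) (product-d≤ (suc j) l (trans (sym (+-suc j (2 + l))) eq)) ⟩
    (n ∸ j) * b j * ((2 + l) ! * productFrom b (suc j) l)
      ≡⟨ cong (λ m → m * b j * ((2 + l) ! * productFrom b (suc j) l)) n∸j≡ ⟩
    (3 + l) * b j * ((2 + l) ! * productFrom b (suc j) l)
      ≡⟨ *-interchange (3 + l) (b j) ((2 + l) !) _ ⟩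
    (3 + l) * (2 + l) ! * (b j * productFrom b (suc j) l) ∎
    where
    open ≤-Reasoning
    j<n : j < n
    j<n = subst (j <_) eq (m<m+n j (s≤s z≤n))
    n∸j≡ : n ∸ j ≡ 3 + l
    n∸j≡ = trans (cong (_∸ j) (sym eq)) (m+n∸m≡n j (3 + l))
    lemma : ∀ x y → 2 * (x * y) ≡ x * (2 * y)
    lemma = solve-∀

-- Products of the reference sequence.

b²<b-suc : ∀ k → b k * b k < b (suc k)
b²<b-suc k = subst (b k * b k <_) (sym (trans (b-suc k) (*-suc (b k) (b k)))) (m<n+m (b k * b k) (0<b k))

-- The spare factor `b j` merges with the first factor of the product into less than `b (suc j)`,
-- the next spare factor. In the end one square remains, and a single merge already makes the
-- inequality strict.
b*product≤ : ∀ j l → b j * productFrom b j (suc l) ≤ b (j + l) ^ 2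
b*product< : ∀ j l → b j * productFrom b j (2 + l) < b (j + suc l) ^ 2
b*product≤ j zero    = ≤-reflexive (cong (λ i → b i * (b i * 1)) (sym (+-identityʳ j)))
b*product≤ j (suc l) = <⇒≤ (b*product< j l)
b*product< j l = begin-strict
  b j * (b j * P)      ≡⟨ *-assoc (b j) (b j) P ⟨
  b j * b j * P        <⟨ *-monoˡ-< P {{>-nonZero (0<P (suc j) (suc l))}} (b²<b-suc j) ⟩
  b (suc j) * P        ≤⟨ b*product≤ (suc j) l ⟩
  b (suc j + l) ^ 2    ≡⟨ cong (λ i → b i ^ 2) (+-suc j l) ⟨
  b (j + suc l) ^ 2    ∎
  where
  open ≤-Reasoning
  P = productFrom b (suc j) (suc l)
  0<P : ∀ j l → 0 < productFrom b j l
  0<P j zero    = s≤s z≤n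
  0<P j (suc l) = *-mono-< (0<b j) (0<P (suc j) l)

-- Since `b 0` is 1, it can serve as the spare factor. For m = 0 both sides are 1 by the convention
-- `a 0 = 1`.
product-b≤ : ∀ m → productFrom b 0 m ≤ a m ^ 2
product-b≤ zero    = ≤-refl
product-b≤ (suc m) = ≤-trans (≤-reflexive (sym (*-identityˡ _))) (b*product≤ 0 m)

product-b< : ∀ m → 2 ≤ m → productFrom b 0 m < a m ^ 2
product-b< (suc (suc m)) _ = ≤-<-trans (≤-reflexive (sym (*-identityˡ _))) (b*product< 0 m)
product-b< (suc zero) (s≤s ())

-- The sequence x, y₁, y₂, …, continued constantly by the last entry.
entry : ∀ {A : Set} → A → List A → ℕ → A
entry x ys       zero    = x
entry x []       (suc k) = x
entry x (y ∷ ys) (suc k) = entry y ys k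

entry-mono : ∀ {A : Set} (D : A → ℕ) x ys → Linked (λ u v → D u ≤ D v) (x ∷ ys) →
  ∀ k → D (entry x ys k) ≤ D (entry x ys (suc k))
entry-mono D x []       x↗         zero    = ≤-refl
entry-mono D x []       x↗         (suc k) = ≤-refl
entry-mono D x (y ∷ ys) (x≤y ∷ y↗) zero    = x≤y
entry-mono D x (y ∷ ys) (x≤y ∷ y↗) (suc k) = entry-mono D y ys y↗ k

foldFrom-suc : ∀ _∙_ ε f j l → foldFrom _∙_ ε f (suc j) l ≡ foldFrom _∙_ ε (f ∘ suc) j l
foldFrom-suc _∙_ ε f j zero    = refl
foldFrom-suc _∙_ ε f j (suc l) = cong (f (suc j) ∙_) (foldFrom-suc _∙_ ε f (suc j) l)

-- Stated for a prefix, this covers both the product without the last two entries and, with empty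
-- `zs`, the full sum. The singleton is separate because `entry` moves on to a new head only if one
-- exists.
foldFrom-entry : ∀ {A : Set} _∙_ ε (f : A → ℕ) x xs is zs → x ∷ xs ≡ is ++ zs →
  foldFrom _∙_ ε (f ∘ entry x xs) 0 (length is) ≡ foldr _∙_ ε (map f is)
foldFrom-entry _∙_ ε f x xs []           zs eq   = refl
foldFrom-entry _∙_ ε f x xs (i ∷ [])     zs refl = refl
foldFrom-entry _∙_ ε f x xs (i ∷ is@(i′ ∷ is′)) zs refl = cong (f x ∙_)
  (trans (foldFrom-suc _∙_ ε (f ∘ entry x xs) 0 (length is))
    (foldFrom-entry _∙_ ε f i′ (is′ ++ zs) is zs refl))

split-last-two : ∀ {A : Set} m (xs : List A) → length xs ≡ 2 + m →
  ∃ λ is → ∃ λ v → ∃ λ u → xs ≡ is ++ v ∷ u ∷ [] × length is ≡ m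
split-last-two zero    (v ∷ u ∷ []) eq = [] , v , u , refl , refl
split-last-two (suc m) (x ∷ xs)     eq with split-last-two m xs (suc-injective eq)
... | is , v , u , refl , refl = x ∷ is , v , u , refl , refl

sum-tabulate : ∀ {n} (f : Fin n → ℕ) → sum (tabulate f) ≡ ∑ℕ.sum f
sum-tabulate {zero}  f = refl
sum-tabulate {suc n} f = cong (f zero +_) (sum-tabulate (f ∘ suc))

-- Sorting the denominators and bounding the order.

module _ {m} (D r : Fin (2 + m) → ℕ) (R : ℕ) (0<R : 0 < R)
  (r*D≡R : ∀ i → r i * D i ≡ R) (R∣∑r : R ∣ ∑ℕ.sum r) where

  open Residues D r R 0<R r*D≡R R∣∑r using (decSetoid; finite)

  private
    module Sorting = Sort (On.decTotalOrder ≤-decTotalOrder D)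

    sorted : List (Fin (2 + m))
    sorted = Sorting.sort (allFin (2 + m))

    length-sorted : length sorted ≡ 2 + m
    length-sorted = trans (↭-length (Sorting.sort-↭ (allFin (2 + m))))
      (length-tabulate {n = 2 + m} (λ i → i))

    sum-sorted : sum (map r sorted) ≡ ∑ℕ.sum r
    sum-sorted = trans (sum-↭ (map⁺ r (Sorting.sort-↭ (allFin (2 + m)))))
      (trans (cong sum (map-tabulate (λ i → i) r)) (sum-tabulate r))

    -- A variable `xs` equal to `sorted` makes it possible to match on its head, which `entry`
    -- requires.
    sorted-product≤ : ∀ {xs} → xs ≡ sorted → ∀ is zs → xs ≡ is ++ zs → length is ≡ m →
      2 * product (map D is) ≤ (2 + m) ! * productFrom b 0 m
    sorted-product≤ {[]} eq is zs _ _ with () ← trans (cong length eq) length-sorted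
    sorted-product≤ {x ∷ xs} eq is zs split length≡ =
      subst (λ p → 2 * p ≤ (2 + m) ! * productFrom b 0 m)
        (trans (cong (productFrom (D ∘ entry x xs) 0) (sym length≡))
          (foldFrom-entry _*_ 1 D x xs is zs split))
        (product-d≤ 0 m refl)
      where
      sum-entry : sumFrom (r ∘ entry x xs) 0 (2 + m) ≡ ∑ℕ.sum r
      sum-entry = begin
        sumFrom (r ∘ entry x xs) 0 (2 + m)
          ≡⟨ cong (sumFrom (r ∘ entry x xs) 0) (trans (cong length eq) length-sorted) ⟨
        sumFrom (r ∘ entry x xs) 0 (length (x ∷ xs))
          ≡⟨ foldFrom-entry _+_ 0 r x xs (x ∷ xs) [] (sym (++-identityʳ (x ∷ xs))) ⟩
        sum (map r (x ∷ xs)) ≡⟨ cong (sum ∘ map r) eq ⟩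
        sum (map r sorted)   ≡⟨ sum-sorted ⟩
        ∑ℕ.sum r             ∎
        where
        open ≡-Reasoning
      open EgyptianFractions (2 + m) R (D ∘ entry x xs) (r ∘ entry x xs) 0<R
        (λ k → r*D≡R (entry x xs k))
        (entry-mono D x xs (subst (Linked _) (sym eq) (Sorting.sort-↗ (allFin (2 + m)))))
        (subst (R ∣_) (sym sum-entry) R∣∑r)

  BoundedOrder : Set
  BoundedOrder = ∃ λ k → Inverse (DecSetoid.setoid decSetoid) (setoid (Fin k)) ×
    2 * k ≤ (2 + m) ! * a m ^ 2 × (4 ≤ 2 + m → 2 * k < (2 + m) ! * a m ^ 2)

  residues-order : BoundedOrder
  residues-order = from-split (split-last-two m sorted length-sorted)
    where
    from-product : ∀ p → 2 * p ≤ (2 + m) ! * productFrom b 0 m →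
      (∃ λ k → Inverse (DecSetoid.setoid decSetoid) (setoid (Fin k)) × k ≤ p) → BoundedOrder
    from-product p 2p≤ (k , inverse , k≤p) = k , inverse
      , ≤-trans 2k≤ (*-monoʳ-≤ ((2 + m) !) (product-b≤ m))
      -- 4 ≤ 2 + m amounts to 2 ≤ m, where the product of the reference sequence is strictly below
      -- the square.
      , λ { (s≤s (s≤s 2≤m)) → ≤-<-trans 2k≤ (*-monoʳ-< ((2 + m) !) {{(2 + m) !≢0}} (product-b< m 2≤m)) }
      where
      2k≤ : 2 * k ≤ (2 + m) ! * productFrom b 0 m
      2k≤ = ≤-trans (*-monoʳ-≤ 2 k≤p) 2p≤

    from-split : (∃ λ is → ∃ λ v → ∃ λ u → sorted ≡ is ++ v ∷ u ∷ [] × length is ≡ m) → BoundedOrder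
    from-split (is , v , u , split , length≡) = from-product (product (map D is))
      (sorted-product≤ refl is (v ∷ u ∷ []) split length≡) (finite u v is cover)
      where
      -- `sorted` is a permutation of all indices, so an index outside `is` is one of the last two.
      cover : ∀ i → i ≡ u ⊎ i ≡ v ⊎ i ∈ is
      cover i with ∈-++⁻ is (subst (i ∈_) split
                     (∈-resp-↭ (↭-sym (Sorting.sort-↭ (allFin (2 + m)))) (∈-allFin i)))
      ... | inj₁ i∈is                = inj₂ (inj₂ i∈is)
      ... | inj₂ (here i≡v)          = inj₂ (inj₁ i≡v)
      ... | inj₂ (there (here i≡u))  = inj₁ i≡u

theorem23 : (n : ℕ) → 2 ≤ n → (G : Graph) → G ≡ star n ⊎ G ≡ complete n →
    (s : ArithmeticalStructure G) →
    ∃ λ k → HasOrder (criticalGroup s) k ×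
    2 * k ≤ n ! * a (n ∸ 2) ^ 2 ×
    (4 ≤ n → 2 * k < n ! * a (n ∸ 2) ^ 2)
theorem23 (suc (suc m)) (s≤s (s≤s _)) _ (inj₁ refl) s =
  let k , inverse , bounds = residues-order D r R (positive zero) r*D≡R R∣∑r
  in  k , Composition.inverse criticalGroup↔residues inverse , bounds
  where
  open ArithmeticalStructure s using (positive)
  open StarGroup s
theorem23 (suc (suc m)) (s≤s (s≤s _)) _ (inj₂ refl) s =
  let k , inverse , bounds = residues-order D r R 0<R r*D≡R R∣∑r
  in  k , Composition.inverse criticalGroup↔residues inverse , bounds
  where
  open ArithmeticalStructure s using (r)
  open CompleteGroup s
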